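{- Let $A$ and $B$ be configurations such that $|A|=|B|=:N$ and: (i) $\mathrm{span}(A)\supseteq B$, and $\mathrm{span}(A)$ is a single $m\times n$ rectangle; (ii) $A$ has 2 extra coins; (iii) $B$ has 2 redundant coins; (iv) $N\geq\frac{3}{2}\max(\min_A,\min_B)+2$. Then $A\to B$.
   Context: The board is the square grid: positions are the elements of $\mathbb{Z}^2$, each position having four neighbors (left, right, top, bottom). A configuration is a finite subset $C\subset\mathbb{Z}^2$; its elements are called coins. A (legal) move $c\mapsto p$ from a configuration $A$ takes $c\in A$ and $p\notin A$ such that $p$ has at least two neighbors in $A\setminus\{c\}$, and produces $(A\setminus\{c\})\cup\{p\}$. We write $A\to B$ if $B$ can be obtained from $A$ by a finite (possibly empty) sequence of moves. The span of a configuration $C$, $\mathrm{span}(C)$, is the limit of the (eventually constant) sequence $C_0=C$, $C_{i+1}=C_i\cup\{p\notin C_i : p \text{ has at least two neighbors in } C_i\}$. An $m\times n$ rectangle is a set $I\times J$ with $I,J$ intervals of integers of cardinality $m$ and $n$ respectively. For a configuration $C$, $\min_C$ denotes the minimum of $|C'|$ over all configurations $C'$ with $\mathrm{span}(C')=\mathrm{span}(C)$. A configuration $A$ has $k$ extra coins if there is $A'\subset A$ with $|A'|=k$ and $\mathrm{span}(A\setminus A')=\mathrm{span}(A)$. A configuration $B$ has $k$ redundant coins if there are $k$ distinct coins $b_1,\ldots,b_k\in B$ such that for all $i$, $b_i$ has at least two neighbors in $B\setminus\{b_1,\ldots,b_{i-1}\}$. -}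

module Defs where

open import Data.Fin using (Fin; _<_)
open import Data.Integer as ℤ using (ℤ; +_)
open import Data.List using (List; []; _∷_; length)
open import Data.List.Membership.Propositional using () renaming (_∈_ to _∈ˡ_)
open import Data.List.Relation.Unary.Unique.Propositional using (Unique)
open import Data.Nat as ℕ using (ℕ; zero; suc)
open import Data.Product using (_×_; _,_; ∃; ∃-syntax; Σ-syntax)
open import Function.Definitions using (Injective)
open import Level using (0ℓ)
open import Relation.Binary.Construct.Closure.ReflexiveTransitive using (Star)
open import Relation.Binary.PropositionalEquality using (_≡_; _≢_)
open import Relation.Unary using (Pred; _∈_; _∉_; _⊆_; _≐_; _∪_; _∖_; ∁; _∩_; ｛_｝)

Position : Set
Position = ℤ × ℤ

PositionSet : Set₁
PositionSet = Pred Position 0ℓ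

neighbors : Position → List Position
neighbors (x , y) =
  (ℤ.pred x , y) ∷ (ℤ.suc x , y) ∷ (x , ℤ.suc y) ∷ (x , ℤ.pred y) ∷ []

HasTwoNeighborsIn : PositionSet → PositionSet
HasTwoNeighborsIn S p =
  ∃[ q ] ∃[ r ] q ≢ r × q ∈ˡ neighbors p × r ∈ˡ neighbors p × q ∈ S × r ∈ S

-- A finite subset of ℤ² is a duplicate-free list of its elements. The order of
-- the list is irrelevant: configurations are always compared through ⟦_⟧ up to
-- _≐_ and never by propositional equality.
record Configuration : Set where
  constructor config
  field
    coins  : List Position
    unique : Unique coins

open Configuration public

⟦_⟧ : Configuration → PositionSet
⟦ C ⟧ p = p ∈ˡ coins C

∣_∣ : Configuration → ℕ
∣ C ∣ = length (coins C)

infix 4 _⟶_ _⟶*_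

_⟶_ : Configuration → Configuration → Set
A ⟶ B = ∃[ c ] ∃[ p ]
    c ∈ ⟦ A ⟧
  × p ∉ ⟦ A ⟧
  × p ∈ HasTwoNeighborsIn (⟦ A ⟧ ∖ ｛ c ｝)
  × ⟦ B ⟧ ≐ (⟦ A ⟧ ∖ ｛ c ｝) ∪ ｛ p ｝

-- Ending at a list with the same elements as B is needed only for the empty
-- sequence of moves, since A and B may then list the same coins differently.
_⟶*_ : Configuration → Configuration → Set
A ⟶* B = ∃[ B′ ] Star _⟶_ A B′ × ⟦ B′ ⟧ ≐ ⟦ B ⟧

growth : PositionSet → ℕ → PositionSet
growth S zero    = S
growth S (suc i) = growth S i ∪ (∁ (growth S i) ∩ HasTwoNeighborsIn (growth S i))

-- The limit of the sequence: the positions that belong to all but finitely many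
-- of its terms. It is only applied to finite sets, for which the sequence is
-- eventually constant.
span : PositionSet → PositionSet
span S p = ∃[ i ] ∀ j → i ℕ.≤ j → p ∈ growth S j

-- The interval {a, …, a + m - 1} of cardinality m.
Interval : ℤ → ℕ → Pred ℤ 0ℓ
Interval a m x = a ℤ.≤ x × x ℤ.< a ℤ.+ (+ m)

IsRectangle : ℕ → ℕ → PositionSet → Set
IsRectangle m n S =
  ∃[ a ] ∃[ b ] S ≐ λ (x , y) → x ∈ Interval a m × y ∈ Interval b n

-- k is the minimum number of coins of a configuration with the same span as C.
IsMin : Configuration → ℕ → Set
IsMin C k =
    (∃[ C′ ] span ⟦ C′ ⟧ ≐ span ⟦ C ⟧ × ∣ C′ ∣ ≡ k)
  × (∀ C′ → span ⟦ C′ ⟧ ≐ span ⟦ C ⟧ → k ℕ.≤ ∣ C′ ∣)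

HasExtraCoins : ℕ → Configuration → Set
HasExtraCoins k A =
  ∃[ A′ ] ⟦ A′ ⟧ ⊆ ⟦ A ⟧ × ∣ A′ ∣ ≡ k × span (⟦ A ⟧ ∖ ⟦ A′ ⟧) ≐ span ⟦ A ⟧

HasRedundantCoins : ℕ → Configuration → Set
HasRedundantCoins k B =
  Σ[ b ∈ (Fin k → Position) ]
    Injective _≡_ _≡_ b
  × (∀ i → b i ∈ ⟦ B ⟧)
  × (∀ i → b i ∈ HasTwoNeighborsIn (⟦ B ⟧ ∖ λ p → ∃[ j ] j < i × b j ≡ p))

{-# OPTIONS --safe #-}
module Submission where

-- If X ⊆ A and |X| < |A|, some coin of A outside X can be moved to any position with two neighbors
-- in X. So it suffices to track a set X: positions with two neighbors in X may be added as long as X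
-- has fewer than N coins, and coins may be forgotten at will. Starting from A without its two extra
-- coins, the goal is B without its two redundant ones, which can then be put back.
--
-- A rectangle is spanned by a chain of coins from one corner to the opposite one with steps (2 , 0),
-- (1 , 1), (0 , 2) and at most one unit step. With two spare coins, all such chains of a rectangle can
-- be transformed into each other, in both directions. Hence two rectangles at distance at most 2 can be
-- merged, again in both directions, by absorbing the coins of one chain one at a time, and every set X
-- is equivalent to a family of chains of pairwise distant rectangles, which are the components of its
-- span. So sets with the same span reach each other with two spare coins, and such chains are minimal.
--
-- It remains to go from a chain of the rectangle R = span A to a minimal set P with the span of B.
-- Choose nested rectangles R ⊃ half ⊃ quarter ⊃ {c} with c ∈ P, each half keeping at least half of the
-- coins of P. From a chain of one rectangle and the coins of P outside it, recover the coins of P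
-- outside the next one, then shrink the chain. The bound 3/2 max(min_A, min_B) + 2 pays for each stage.

open import Defs

-- Write M for the larger of the two minima. Recovering all of P next to a complete chain of R could
-- take 2M coins. The nested rectangles trade one for the other: the chain and the recovered coins
-- take about M + M/2, then 3M/4 + 3M/4, then M/2 + M. Each sum is 3M/2, which is where the factor
-- 3/2 comes from; the summand 2 is the pair of spare coins that the reversible transformations
-- need. Shrinking a chain is irreversible, so the coins of P outside the smaller rectangle have to
-- be on the board before the chain shrinks.
--
-- The obstacle throughout is parity. A minimal chain has room for at most one unit step, so a cell
-- at odd distance from both ends of every such chain lies on none of them. This affects absorbing a
-- coin inside a rectangle as well as merging rectangles, and it explains the evenness hypotheses
-- and the exceptional cells below.

module CoinGame where

  open import Data.Bool using (T)
  open import Data.Empty using (⊥; ⊥-elim)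
  open import Data.Fin as Fin using (Fin; toℕ; fromℕ<)
  open import Data.Fin.Properties as Fin using (toℕ<n; toℕ-fromℕ<)
  open import Data.Integer as ℤ using (ℤ)
  import Data.Integer.Properties as ℤ
  open import Algebra.Properties.AbelianGroup ℤ.+-0-abelianGroup using
      (∙-cancelˡ; ∙-cancelʳ; identityˡ-unique)
  import Data.Integer.Tactic.RingSolver as ℤ using (solve-∀)
  open import Data.List using (List; []; _∷_; _++_; [_]; map; length; filter; concatMap)
  open import Data.List.Membership.Propositional using (_∈_; _∉_; find; lose)
  open import Data.List.Membership.Propositional.Properties using
      (∈-map⁺; ∈-map⁻; ∈-++⁺ˡ; ∈-++⁺ʳ; ∈-++⁻; ∈-∃++; ∈-filter⁺; ∈-filter⁻; ∈-concatMap⁺;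
      ∈-concatMap⁻)
  open import Data.List.Properties using
      (length-++; length-map; map-++; ++-assoc; map-∘; map-cong; map-id; ++-identityʳ;
      filter-notAll; filter-all)
  open import Data.List.Relation.Binary.Permutation.Propositional as Perm using
      (_↭_; ↭-sym; ↭-trans; ↭-refl; ↭-reflexive; prep; ↭⇒↭ₛ)
  open import Data.List.Relation.Binary.Permutation.Propositional.Properties using
      (∈-resp-↭; ++-comm; ++⁺ʳ; ++⁺ˡ; ∷↭∷ʳ; ↭-length; shifts; All-resp-↭; Any-resp-↭) renaming
      (shift to ↭-shift)
  import Data.List.Relation.Binary.Permutation.Setoid.Properties as ↭ₛ
  open import Data.List.Relation.Binary.Subset.Propositional using (_⊆_)
  import Data.List.Relation.Binary.Subset.Propositional.Properties as ⊆
  open import Data.List.Relation.Unary.All as All using (All; []; _∷_; all?)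
  open import Data.List.Relation.Unary.All.Properties using (¬All⇒Any¬; ¬Any⇒All¬)
  open import Data.List.Relation.Unary.AllPairs as AllPairs using (AllPairs; []; _∷_)
  open import Data.List.Relation.Unary.Any using (Any; here; there; any?)
  open import Data.List.Relation.Unary.Unique.Propositional using (Unique)
  import Data.List.Relation.Unary.Unique.Propositional.Properties as Unique
  open import Data.Maybe as Maybe using (Maybe; just; nothing; _>>=_; is-just)
  open import Data.Nat as ℕ using (ℕ; zero; suc; _+_; _*_; _≤_; _<_; s≤s; z≤n; ⌊_/2⌋; ⌈_/2⌉)
  open import Data.Nat.Properties as ℕ using (≤-refl; ≤-trans; ≤-reflexive)
  import Data.Nat.Tactic.RingSolver as ℕ using (solve-∀)
  open import Data.Product using (_×_; _,_; proj₁; proj₂; ∃-syntax; swap)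
  open import Data.Product.Properties using (≡-dec)
  open import Data.Rational.Unnormalised as ℚᵘ using (*≤*)
  open import Data.Sum as Sum using (_⊎_; inj₁; inj₂)
  open import Data.Unit using (⊤)
  open import Function using (_∘_; id)
  open import Level using (0ℓ)
  open import Relation.Binary using (DecidableEquality; Setoid)
  open import Relation.Binary.Construct.Closure.ReflexiveTransitive as Star using
      (Star; ε; _◅_; _◅◅_)
  open import Relation.Binary.PropositionalEquality using
      (_≡_; _≢_; refl; sym; trans; cong; cong₂; subst; subst₂; setoid)
  open import Relation.Nullary using (¬_; Dec; yes; no)
  open import Relation.Nullary.Decidable using (¬?; _×-dec_; map′)
  open import Relation.Unary using (Decidable; _≐_)

  _≟_ : DecidableEquality Position
  _≟_ = ≡-dec ℤ._≟_ ℤ._≟_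

  open import Data.List.Membership.DecPropositional _≟_ using (_∈?_)

  -- Tracked sets of coins and their transformations

  Supported : Position → List Position → Set
  Supported p X = HasTwoNeighborsIn (_∈ X) p

  Closed : PositionSet → Set
  Closed C = ∀ {p} → HasTwoNeighborsIn C p → C p

  twoNeighbors-mono : {S T : PositionSet} {p : Position} → (∀ {q} → S q → T q) →
    HasTwoNeighborsIn S p → HasTwoNeighborsIn T p
  twoNeighbors-mono S⊆T (q , r , q≢r , nq , nr , Sq , Sr) = q , r , q≢r , nq , nr , S⊆T Sq , S⊆T Sr

  -- Only the coins in X are tracked. Forgetting, reordering or repeating coins is free; a list with
  -- repetitions is longer than the set it stands for, so the capacity c is then used less than fully.
  data Step (c : ℕ) (X : List Position) : List Position → Set where
    weaken : ∀ {Y} → Y ⊆ X → Step c X Y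
    grow   : ∀ {p} → length X < c → Supported p X → Step c X (p ∷ X)

  infix 4 _⇒[_]_

  _⇒[_]_ : List Position → ℕ → List Position → Set
  X ⇒[ c ] Y = Star (Step c) X Y

  private
    variable
      c c′ : ℕ
      X Y Z : List Position

  ⊆⇒ : Y ⊆ X → X ⇒[ c ] Y
  ⊆⇒ Y⊆X = weaken Y⊆X ◅ ε

  cap-mono : c ≤ c′ → X ⇒[ c ] Y → X ⇒[ c′ ] Y
  cap-mono c≤c′ = Star.map λ where
    (weaken Y⊆X) → weaken Y⊆X
    (grow <c s)  → grow (≤-trans <c c≤c′) s

  -- The coins of Z are bystanders: they count towards the capacity but never obstruct a step, since
  -- growing asks only for the presence of two supports and lists may repeat a position.
  frame : ∀ Z → X ⇒[ c ] Y → X ++ Z ⇒[ length Z + c ] Y ++ Z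
  frame {c = c} Z = Star.gmap (_++ Z) step
    where
    step : ∀ {X Y} → Step c X Y → Step (length Z + c) (X ++ Z) (Y ++ Z)
    step (weaken Y⊆X)    = weaken (⊆.++⁺ˡ Z Y⊆X)
    step {X} (grow <c s)  =
      grow (ℕ.≤-<-trans (≤-reflexive (trans (length-++ X) (ℕ.+-comm (length X) _)))
                        (ℕ.+-monoʳ-< (length Z) <c))
           (twoNeighbors-mono ∈-++⁺ˡ s)

  ⇒-closed : {C : PositionSet} → Closed C → X ⇒[ c ] Y →
    (∀ {p} → p ∈ X → C p) → (∀ {p} → p ∈ Y → C p)
  ⇒-closed closed ε X⊆C = X⊆C
  ⇒-closed closed (weaken Y⊆X ◅ ss) X⊆C = ⇒-closed closed ss (X⊆C ∘ Y⊆X)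
  ⇒-closed closed (grow _ s ◅ ss) X⊆C = ⇒-closed closed ss λ where
    (here refl) → closed (twoNeighbors-mono X⊆C s)
    (there p∈X) → X⊆C p∈X

  record IsIsometry (σ : Position → Position) : Set where
    field
      injective : ∀ {p q} → σ p ≡ σ q → p ≡ q
      neighbor  : ∀ {p q} → q ∈ neighbors p → σ q ∈ neighbors (σ p)

  map-⇒ : ∀ {σ} → IsIsometry σ → X ⇒[ c ] Y → map σ X ⇒[ c ] map σ Y
  map-⇒ {c = c} {σ = σ} iso = Star.gmap (map σ) step
    where
    open IsIsometry iso
    step : ∀ {X Y} → Step c X Y → Step c (map σ X) (map σ Y)
    step (weaken Y⊆X) = weaken (⊆.map⁺ σ Y⊆X)
    step {X} (grow <c (q , r , q≢r , nq , nr , q∈X , r∈X)) =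
      grow (subst (_< c) (sym (length-map σ X)) <c)
           (σ q , σ r , q≢r ∘ injective , neighbor nq , neighbor nr , ∈-map⁺ σ q∈X , ∈-map⁺ σ r∈X)

  -- Reversible transformations with two spare coins

  infix 4 _↘_ _≈_

  -- Two spare coins on top of those of X suffice to go from X to Y and back.
  record _↘_ (X Y : List Position) : Set where
    constructor reduction
    field
      shrinks : length Y ≤ length X
      forth   : X ⇒[ 2 + length X ] Y
      back    : Y ⇒[ 2 + length X ] X

  open _↘_ public

  record _≈_ (X Y : List Position) : Set where
    constructor _,_
    field
      to   : X ↘ Y
      from : Y ↘ X

  open _≈_ public

  ↘-refl : X ↘ X
  ↘-refl = reduction ≤-refl ε ε

  ↘-trans : X ↘ Y → Y ↘ Z → X ↘ Z
  ↘-trans (reduction l₁ f₁ b₁) (reduction l₂ f₂ b₂) = reduction (≤-trans l₂ l₁)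
    (f₁ ◅◅ cap-mono (ℕ.+-monoʳ-≤ 2 l₁) f₂) (cap-mono (ℕ.+-monoʳ-≤ 2 l₁) b₂ ◅◅ b₁)

  ↘-frame : ∀ Z → X ↘ Y → X ++ Z ↘ Y ++ Z
  ↘-frame {X} {Y} Z (reduction l f b) = reduction
    (subst₂ _≤_ (sym (length-++ Y)) (sym (length-++ X)) (ℕ.+-monoˡ-≤ (length Z) l))
    (cap-mono cap≤ (frame Z f))
    (cap-mono cap≤ (frame Z b))
    where
    cap≤ : length Z + (2 + length X) ≤ 2 + length (X ++ Z)
    cap≤ = ≤-reflexive (trans (ℕ.+-comm (length Z) _) (cong (2 +_) (sym (length-++ X))))

  ↘-map : ∀ {σ} → IsIsometry σ → X ↘ Y → map σ X ↘ map σ Y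
  ↘-map {X} {Y} {σ} iso (reduction l f b) = reduction
    (subst₂ _≤_ (sym (length-map σ Y)) (sym (length-map σ X)) l)
    (subst (λ n → map σ X ⇒[ 2 + n ] map σ Y) (sym (length-map σ X)) (map-⇒ iso f))
    (subst (λ n → map σ Y ⇒[ 2 + n ] map σ X) (sym (length-map σ X)) (map-⇒ iso b))

  ↘-↭ : X ↭ Y → X ↘ Y
  ↘-↭ X↭Y = reduction (≤-reflexive (sym (↭-length X↭Y)))
    (⊆⇒ (∈-resp-↭ (↭-sym X↭Y))) (⊆⇒ (∈-resp-↭ X↭Y))

  ≈-↭ : X ↭ Y → X ≈ Y
  ≈-↭ X↭Y = ↘-↭ X↭Y , ↘-↭ (↭-sym X↭Y)

  ≈-refl : X ≈ X
  ≈-refl = ↘-refl , ↘-refl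

  ≈-reflexive : X ≡ Y → X ≈ Y
  ≈-reflexive refl = ≈-refl

  ≈-sym : X ≈ Y → Y ≈ X
  ≈-sym (a , b) = b , a

  ≈-trans : X ≈ Y → Y ≈ Z → X ≈ Z
  ≈-trans (a , b) (a′ , b′) = ↘-trans a a′ , ↘-trans b′ b

  ≈-frame : ∀ Z → X ≈ Y → X ++ Z ≈ Y ++ Z
  ≈-frame Z (a , b) = ↘-frame Z a , ↘-frame Z b

  ≈-map : ∀ {σ} → IsIsometry σ → X ≈ Y → map σ X ≈ map σ Y
  ≈-map iso (a , b) = ↘-map iso a , ↘-map iso b

  ≈-length : X ≈ Y → length X ≡ length Y
  ≈-length X≈Y = ℕ.≤-antisym (shrinks (from X≈Y)) (shrinks (to X≈Y))

  ≈-setoid : Setoid 0ℓ 0ℓ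
  ≈-setoid = record
    { Carrier = List Position ; _≈_ = _≈_
    ; isEquivalence = record { refl = ≈-refl ; sym = ≈-sym ; trans = ≈-trans } }

  import Relation.Binary.Reasoning.Setoid ≈-setoid as ≈-Reasoning

  -- Explicit move sequences, checked by computation

  at : ℕ → ℕ → Position
  at i j = ℤ.+ i , ℤ.+ j

  data Move : Set where
    place remove : Position → Move

  supported? : ∀ p X → Maybe (Supported p X)
  supported? p X
    with any? (λ q → any? (λ r → ¬? (q ≟ r) ×-dec (q ∈? X) ×-dec (r ∈? X)) (neighbors p))
        (neighbors p)
  ... | no _ = nothing
  ... | yes two
    with q , nq , one ← find two
    with r , nr , q≢r , q∈X , r∈X ← find one = just (q , r , q≢r , nq , nr , q∈X , r∈X)

  play : ∀ c X Y → List Move → Maybe (X ⇒[ c ] Y)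
  play c X Y [] with all? (_∈? X) Y
  ... | no _    = nothing
  ... | yes Y⊆X = just (⊆⇒ (All.lookup Y⊆X))
  play c X Y (remove p ∷ ms) =
    Maybe.map (weaken (⊆.filter-⊆ (λ q → ¬? (q ≟ p)) X) ◅_)
        (play c (filter (λ q → ¬? (q ≟ p)) X) Y ms)
  play c X Y (place p ∷ ms) with length X ℕ.<? c
  ... | no _   = nothing
  ... | yes <c = do
    s  ← supported? p X
    ss ← play c (p ∷ X) Y ms
    just (grow <c s ◅ ss)

  from-play : (m : Maybe (X ⇒[ c ] Y)) → T (is-just m) → X ⇒[ c ] Y
  from-play (just X⇒Y) _ = X⇒Y

  -- For legal sequences the types of the implicit arguments compute to the unit type and are filled
  -- in automatically, so each use below is verified by evaluating `play` in both directions.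
  by-play : ∀ {X Y} (ms ms′ : List Move) {eq : T (length X ℕ.≡ᵇ length Y)}
    {f : T (is-just (play (2 + length X) X Y ms))}
    {b : T (is-just (play (2 + length Y) Y X ms′))} → X ≈ Y
  by-play {X} {Y} ms ms′ {eq} {f} {b} =
      reduction (≤-reflexive (sym X≡Y)) X⇒Y (subst (λ n → Y ⇒[ 2 + n ] X) (sym X≡Y) Y⇒X)
    , reduction (≤-reflexive X≡Y) Y⇒X (subst (λ n → X ⇒[ 2 + n ] Y) X≡Y X⇒Y)
    where
    X≡Y : length X ≡ length Y
    X≡Y = ℕ.≡ᵇ⇒≡ (length X) (length Y) eq
    X⇒Y : X ⇒[ 2 + length X ] Y
    X⇒Y = from-play (play _ X Y ms) f
    Y⇒X : Y ⇒[ 2 + length Y ] X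
    Y⇒X = from-play (play _ Y X ms′) b

  -- H, V and D stand for the steps (2 , 0), (0 , 2) and (1 , 1) between consecutive coins, h and v for
  -- the unit steps (1 , 0) and (0 , 1). The move sequences were found by breadth-first search.
  HV≈VH : (at 0 0 ∷ at 2 0 ∷ at 2 2 ∷ []) ≈ (at 0 0 ∷ at 0 2 ∷ at 2 2 ∷ [])
  HV≈VH = by-play
    (place (at 2 1) ∷ place (at 1 0) ∷ remove (at 2 0) ∷ place (at 1 1) ∷
     remove (at 2 1) ∷ place (at 0 1) ∷ remove (at 1 0) ∷ place (at 1 2) ∷
     remove (at 1 1) ∷ place (at 0 2) ∷ [])
    (place (at 0 1) ∷ place (at 1 2) ∷ remove (at 0 2) ∷ place (at 1 1) ∷
     remove (at 0 1) ∷ place (at 2 1) ∷ remove (at 1 2) ∷ place (at 1 0) ∷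
     remove (at 1 1) ∷ place (at 2 0) ∷ [])

  HV≈DD : (at 0 0 ∷ at 2 0 ∷ at 2 2 ∷ []) ≈ (at 0 0 ∷ at 1 1 ∷ at 2 2 ∷ [])
  HV≈DD = by-play
    (place (at 2 1) ∷ place (at 1 0) ∷ remove (at 2 0) ∷ place (at 1 1) ∷ [])
    (place (at 2 1) ∷ place (at 1 0) ∷ remove (at 1 1) ∷ place (at 2 0) ∷ [])

  DV≈VD : (at 0 0 ∷ at 1 1 ∷ at 1 3 ∷ []) ≈ (at 0 0 ∷ at 0 2 ∷ at 1 3 ∷ [])
  DV≈VD = by-play
    (place (at 0 1) ∷ place (at 1 2) ∷ remove (at 1 1) ∷ place (at 0 2) ∷ [])
    (place (at 0 1) ∷ place (at 1 2) ∷ remove (at 0 2) ∷ place (at 1 1) ∷ [])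

  HD≈DH : (at 0 0 ∷ at 2 0 ∷ at 3 1 ∷ []) ≈ (at 0 0 ∷ at 1 1 ∷ at 3 1 ∷ [])
  HD≈DH = by-play
    (place (at 2 1) ∷ place (at 1 0) ∷ remove (at 2 0) ∷ place (at 1 1) ∷ [])
    (place (at 2 1) ∷ place (at 1 0) ∷ remove (at 1 1) ∷ place (at 2 0) ∷ [])

  Dv≈Vh : (at 0 0 ∷ at 1 1 ∷ at 1 2 ∷ []) ≈ (at 0 0 ∷ at 0 2 ∷ at 1 2 ∷ [])
  Dv≈Vh = by-play
    (place (at 0 1) ∷ place (at 0 2) ∷ [])
    (place (at 0 1) ∷ place (at 1 1) ∷ [])

  Hv≈Dh : (at 0 0 ∷ at 2 0 ∷ at 2 1 ∷ []) ≈ (at 0 0 ∷ at 1 1 ∷ at 2 1 ∷ [])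
  Hv≈Dh = by-play
    (place (at 1 0) ∷ place (at 1 1) ∷ [])
    (place (at 1 0) ∷ place (at 2 0) ∷ [])

  Dv≈hV : (at 0 0 ∷ at 1 1 ∷ at 1 2 ∷ []) ≈ (at 0 0 ∷ at 1 0 ∷ at 1 2 ∷ [])
  Dv≈hV = by-play
    (place (at 1 0) ∷ [])
    (place (at 1 1) ∷ [])

  Hv≈hD : (at 0 0 ∷ at 2 0 ∷ at 2 1 ∷ []) ≈ (at 0 0 ∷ at 1 0 ∷ at 2 1 ∷ [])
  Hv≈hD = by-play
    (place (at 1 0) ∷ [])
    (place (at 2 0) ∷ [])

  Hh≈hH : (at 0 0 ∷ at 2 0 ∷ at 3 0 ∷ []) ≈ (at 0 0 ∷ at 1 0 ∷ at 3 0 ∷ [])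
  Hh≈hH = by-play
    (place (at 1 0) ∷ [])
    (place (at 2 0) ∷ [])

  Vv≈vV : (at 0 0 ∷ at 0 2 ∷ at 0 3 ∷ []) ≈ (at 0 0 ∷ at 0 1 ∷ at 0 3 ∷ [])
  Vv≈vV = by-play
    (place (at 0 1) ∷ [])
    (place (at 0 2) ∷ [])

  Dv≈vD : (at 0 0 ∷ at 1 1 ∷ at 1 2 ∷ []) ≈ (at 0 0 ∷ at 0 1 ∷ at 1 2 ∷ [])
  Dv≈vD = by-play
    (place (at 0 1) ∷ [])
    (place (at 1 1) ∷ [])

  Hv≈vH : (at 0 0 ∷ at 2 0 ∷ at 2 1 ∷ []) ≈ (at 0 0 ∷ at 0 1 ∷ at 2 1 ∷ [])
  Hv≈vH = by-play
    (place (at 1 0) ∷ place (at 1 1) ∷ remove (at 1 0) ∷ place (at 0 1) ∷ [])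
    (place (at 1 1) ∷ place (at 1 0) ∷ remove (at 0 1) ∷ place (at 2 0) ∷ [])

  slideHˡ₁ : (at 0 0 ∷ at 2 0 ∷ at 0 1 ∷ []) ≈ (at 0 0 ∷ at 2 0 ∷ at 1 1 ∷ [])
  slideHˡ₁ = by-play
    (place (at 1 0) ∷ place (at 1 1) ∷ [])
    (place (at 0 1) ∷ [])

  slideHʳ₁ : (at 0 0 ∷ at 2 0 ∷ at 1 1 ∷ []) ≈ (at 0 0 ∷ at 2 0 ∷ at 2 1 ∷ [])
  slideHʳ₁ = by-play
    (place (at 2 1) ∷ [])
    (place (at 1 0) ∷ place (at 1 1) ∷ [])

  slideh₁ : (at 0 0 ∷ at 1 0 ∷ at 0 1 ∷ []) ≈ (at 0 0 ∷ at 1 0 ∷ at 1 1 ∷ [])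
  slideh₁ = by-play
    (place (at 1 1) ∷ [])
    (place (at 0 1) ∷ [])

  slideD₁ : (at 0 0 ∷ at 1 1 ∷ at 0 2 ∷ []) ≈ (at 0 0 ∷ at 1 1 ∷ at 1 2 ∷ [])
  slideD₁ = by-play
    (place (at 1 2) ∷ [])
    (place (at 0 1) ∷ place (at 0 2) ∷ [])

  slideHˡ₂ : (at 0 0 ∷ at 2 0 ∷ at 0 2 ∷ []) ≈ (at 0 0 ∷ at 2 0 ∷ at 1 2 ∷ [])
  slideHˡ₂ = by-play
    (place (at 0 1) ∷ place (at 1 0) ∷ remove (at 0 0) ∷ place (at 1 1) ∷
     remove (at 1 0) ∷ place (at 1 2) ∷ remove (at 0 2) ∷ place (at 1 0) ∷
     remove (at 1 1) ∷ place (at 0 0) ∷ [])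
    (place (at 1 0) ∷ place (at 1 1) ∷ remove (at 1 0) ∷ place (at 0 1) ∷
     remove (at 1 1) ∷ place (at 0 2) ∷ [])

  slideHʳ₂ : (at 0 0 ∷ at 2 0 ∷ at 1 2 ∷ []) ≈ (at 0 0 ∷ at 2 0 ∷ at 2 2 ∷ [])
  slideHʳ₂ = by-play
    (place (at 1 0) ∷ place (at 1 1) ∷ remove (at 1 0) ∷ place (at 2 1) ∷
     remove (at 1 1) ∷ place (at 2 2) ∷ [])
    (place (at 2 1) ∷ place (at 1 0) ∷ remove (at 2 0) ∷ place (at 1 1) ∷
     remove (at 1 0) ∷ place (at 1 2) ∷ remove (at 2 2) ∷ place (at 1 0) ∷
     remove (at 1 1) ∷ place (at 2 0) ∷ [])

  slideh₂ : (at 0 0 ∷ at 1 0 ∷ at 0 2 ∷ []) ≈ (at 0 0 ∷ at 1 0 ∷ at 1 2 ∷ [])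
  slideh₂ = by-play
    (place (at 0 1) ∷ place (at 1 1) ∷ remove (at 0 1) ∷ place (at 1 2) ∷ [])
    (place (at 1 1) ∷ place (at 0 1) ∷ remove (at 1 1) ∷ place (at 0 2) ∷ [])

  slideD₂ : (at 0 0 ∷ at 1 1 ∷ at 0 3 ∷ []) ≈ (at 0 0 ∷ at 1 1 ∷ at 1 3 ∷ [])
  slideD₂ = by-play
    (place (at 0 1) ∷ place (at 0 2) ∷ remove (at 0 1) ∷ place (at 1 2) ∷
     remove (at 0 2) ∷ place (at 1 3) ∷ [])
    (place (at 0 1) ∷ place (at 1 2) ∷ remove (at 1 1) ∷ place (at 0 2) ∷
     remove (at 0 1) ∷ place (at 0 3) ∷ remove (at 1 3) ∷ place (at 0 1) ∷
     remove (at 0 2) ∷ place (at 1 1) ∷ [])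

  square-flip : (at 0 0 ∷ at 1 1 ∷ []) ≈ (at 1 0 ∷ at 0 1 ∷ [])
  square-flip = by-play
    (place (at 0 1) ∷ place (at 1 0) ∷ [])
    (place (at 0 0) ∷ place (at 1 1) ∷ [])

  -- Isometries

  shift : Position → Position → Position
  shift (a , b) (x , y) = x ℤ.+ a , y ℤ.+ b

  reflect : ℤ → Position → Position
  reflect a (x , y) = a ℤ.- x , y

  shift-isometry : ∀ a → IsIsometry (shift a)
  shift-isometry (a , b) = record
    { injective = λ eq → cong₂ _,_ (∙-cancelʳ a _ _ (cong proj₁ eq))
        (∙-cancelʳ b _ _ (cong proj₂ eq))
    ; neighbor  = shifted
    }
    where
    shifted : ∀ {p q} → q ∈ neighbors p → shift (a , b) q ∈ neighbors (shift (a , b) p)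
    shifted {x , y} (here refl)                 = here (cong (_, y ℤ.+ b) (ℤ.+-assoc ℤ.-1ℤ x a))
    shifted {x , y} (there (here refl))         =
        there (here (cong (_, y ℤ.+ b) (ℤ.+-assoc ℤ.1ℤ x a)))
    shifted {x , y} (there (there (here refl))) =
      there (there (here (cong (x ℤ.+ a ,_) (ℤ.+-assoc ℤ.1ℤ y b))))
    shifted {x , y} (there (there (there (here refl)))) =
      there (there (there (here (cong (x ℤ.+ a ,_) (ℤ.+-assoc ℤ.-1ℤ y b)))))

  swap-isometry : IsIsometry swap
  swap-isometry = record
    { injective = cong swap
    ; neighbor  = λ where
        (here refl)                         → there (there (there (here refl)))
        (there (here refl))                 → there (there (here refl))
        (there (there (here refl)))         → there (here refl)
        (there (there (there (here refl)))) → here refl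
    }

  reflect-isometry : ∀ a → IsIsometry (reflect a)
  reflect-isometry a = record
    { injective = λ eq →
        cong₂ _,_ (ℤ.neg-injective (∙-cancelˡ a _ _ (cong proj₁ eq))) (cong proj₂ eq)
    ; neighbor  = reflected
    }
    where
    reflect-pred : ∀ a x → a ℤ.- (ℤ.-1ℤ ℤ.+ x) ≡ ℤ.1ℤ ℤ.+ (a ℤ.- x)
    reflect-pred = ℤ.solve-∀
    reflect-suc : ∀ a x → a ℤ.- (ℤ.1ℤ ℤ.+ x) ≡ ℤ.-1ℤ ℤ.+ (a ℤ.- x)
    reflect-suc = ℤ.solve-∀
    reflected : ∀ {p q} → q ∈ neighbors p → reflect a q ∈ neighbors (reflect a p)
    reflected {x , y} (here refl)                         =
        there (here (cong (_, y) (reflect-pred a x)))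
    reflected {x , y} (there (here refl))                 = here (cong (_, y) (reflect-suc a x))
    reflected {x , y} (there (there (here refl)))         = there (there (here refl))
    reflected {x , y} (there (there (there (here refl)))) = there (there (there (here refl)))

  shift-shift : ∀ s t X → map (shift s) (map (shift t) X) ≡ map (shift (shift s t)) X
  shift-shift s t X = trans (sym (map-∘ X))
    (map-cong (λ p → cong₂ _,_ (ℤ.+-assoc (proj₁ p) _ _) (ℤ.+-assoc (proj₂ p) _ _)) X)

  shift-at : ∀ a b i j → shift (at a b) (at i j) ≡ at (a + i) (b + j)
  shift-at a b i j = cong₂ at (ℕ.+-comm i a) (ℕ.+-comm j b)

  shift-identity : ∀ X → map (shift (at 0 0)) X ≡ X
  shift-identity X = trans
    (map-cong (λ p → cong₂ _,_ (ℤ.+-identityʳ (proj₁ p)) (ℤ.+-identityʳ (proj₂ p))) X) (map-id X)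

  -- Chains

  -- Removing two computes away, so evidence of evenness passes unchanged through the inductions
  -- below, which shorten chains by steps of length 2. Oddness of n is expressed as `Even (suc n)`.
  Even : ℕ → Set
  Even 0             = ⊤
  Even 1             = ⊥
  Even (suc (suc n)) = Even n

  parity : ∀ n → Even n ⊎ Even (suc n)
  parity 0             = inj₁ _
  parity 1             = inj₂ _
  parity (suc (suc n)) = parity n

  infixr 5 _▹_

  _▹_ : Position → List Position → List Position
  s ▹ X = at 0 0 ∷ map (shift s) X

  -- The greedy route: horizontal double steps, a diagonal step if one column and some row remain,
  -- vertical double steps, and a final unit step exactly when r + v is odd. It has ⌈(r + v)/2⌉ + 1
  -- coins. Leaving out the origin in `links` lets two routes be joined without repeating the common
  -- coin.
  chain links : ℕ → ℕ → List Position
  chain r v = at 0 0 ∷ links r v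
  links (suc (suc r)) v = map (shift (at 2 0)) (chain r v)
  links 1 (suc v)       = map (shift (at 1 1)) (chain 0 v)
  links 1 0             = [ at 1 0 ]
  links 0 (suc (suc v)) = map (shift (at 0 2)) (chain 0 v)
  links 0 1             = [ at 0 1 ]
  links 0 0             = []

  ∷-cong : ∀ p {X Y} → X ≈ Y → p ∷ X ≈ p ∷ Y
  ∷-cong p {X} {Y} X≈Y = begin
    p ∷ X    ≈⟨ ≈-↭ (∷↭∷ʳ p X) ⟩
    X ++ [ p ] ≈⟨ ≈-frame [ p ] X≈Y ⟩
    Y ++ [ p ] ≈⟨ ≈-↭ (↭-sym (∷↭∷ʳ p Y)) ⟩
    p ∷ Y    ∎
    where open ≈-Reasoning

  ▹-cong : ∀ s {X Y} → X ≈ Y → s ▹ X ≈ s ▹ Y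
  ▹-cong s X≈Y = ∷-cong (at 0 0) (≈-map (shift-isometry s) X≈Y)

  -- Both pairs of steps lead to the same third coin e, so only the second coin moves and the tail Z
  -- keeps its place as a bystander.
  exchange : ∀ {s t s′ t′ e Z} → shift s t ≡ e → shift s′ t′ ≡ e →
    at 0 0 ∷ s ∷ e ∷ [] ≈ at 0 0 ∷ s′ ∷ e ∷ [] →
    s ▹ t ▹ at 0 0 ∷ Z ≈ s′ ▹ t′ ▹ at 0 0 ∷ Z
  exchange {s} {t} {s′} {t′} {e} {Z} refl eq block = begin
    s ▹ t ▹ at 0 0 ∷ Z                                  ≡⟨ unfold s t ⟩
    (at 0 0 ∷ s ∷ e ∷ []) ++ map (shift e) Z            ≈⟨ ≈-frame _ block ⟩
    (at 0 0 ∷ s′ ∷ e ∷ []) ++ map (shift e) Z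
        ≡⟨ cong (λ e → (at 0 0 ∷ s′ ∷ e ∷ []) ++ map (shift e) Z) eq ⟨
    (at 0 0 ∷ s′ ∷ shift s′ t′ ∷ []) ++ map (shift (shift s′ t′)) Z ≡⟨ unfold s′ t′ ⟨
    s′ ▹ t′ ▹ at 0 0 ∷ Z                                ∎
    where
    open ≈-Reasoning
    origin : ∀ s → shift s (at 0 0) ≡ s
    origin s = cong₂ _,_ (ℤ.+-identityˡ _) (ℤ.+-identityˡ _)
    unfold : ∀ s t → s ▹ t ▹ at 0 0 ∷ Z ≡ (at 0 0 ∷ s ∷ shift s t ∷ []) ++ map (shift (shift s t)) Z
    unfold s t = cong₂ (λ p X → at 0 0 ∷ p ∷ X) (origin s)
      (cong₂ _∷_ (cong (shift s) (origin t)) (shift-shift s t Z))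

  -- The step lemmas let a chain from the origin to (r , v) start with any step that fits; parity
  -- matters for unit steps only, since a chain has room for at most one of them.
  stepV : ∀ r v → chain r (2 + v) ≈ at 0 2 ▹ chain r v
  stepV 0 v             = ≈-refl
  stepV 1 0             = Dv≈Vh
  stepV 1 (suc v)       = exchange refl refl DV≈VD
  stepV (suc (suc r)) v = ≈-trans (▹-cong (at 2 0) (stepV r v)) (exchange refl refl HV≈VH)

  stepD : ∀ r v → chain (1 + r) (1 + v) ≈ at 1 1 ▹ chain r v
  stepD 0 v             = ≈-refl
  stepD 1 0             = Hv≈Dh
  stepD 1 (suc v)       = exchange refl refl HV≈DD
  stepD (suc (suc r)) v = ≈-trans (▹-cong (at 2 0) (stepD r v)) (exchange refl refl HD≈DH)

  stepv : ∀ r v → Even (r + v) → chain r (1 + v) ≈ at 0 1 ▹ chain r v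
  stepv 0 0 _                = ≈-refl
  stepv 0 (suc (suc v)) ev   = ≈-trans (▹-cong (at 0 2) (stepv 0 v ev)) (exchange refl refl Vv≈vV)
  stepv 1 (suc v) ev         = ≈-trans (▹-cong (at 1 1) (stepv 0 v ev)) (exchange refl refl Dv≈vD)
  stepv (suc (suc r)) v ev   = ≈-trans (▹-cong (at 2 0) (stepv r v ev)) (exchange refl refl Hv≈vH)

  steph : ∀ r v → Even (r + v) → chain (1 + r) v ≈ at 1 0 ▹ chain r v
  steph 0 0 _              = ≈-refl
  steph 0 (suc (suc v)) ev = ≈-trans (▹-cong (at 1 1) (stepv 0 v ev)) (exchange refl refl Dv≈hV)
  steph 1 (suc v) ev       = ≈-trans (▹-cong (at 2 0) (stepv 0 v ev)) (exchange refl refl Hv≈hD)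
  steph (suc (suc r)) v ev = ≈-trans (▹-cong (at 2 0) (steph r v ev)) (exchange refl refl Hh≈hH)

  ▹-++ : ∀ a b i j X Z → at a b ▹ (X ++ map (shift (at i j)) Z) ≡ (at a b ▹ X)
      ++ map (shift (at (a + i) (b + j))) Z
  ▹-++ a b i j X Z = cong (at 0 0 ∷_) (trans (map-++ (shift (at a b)) X _)
    (cong (map (shift (at a b)) X ++_) (trans (shift-shift (at a b) (at i j) Z)
      (cong (λ s → map (shift s) Z) (shift-at a b i j)))))

  -- The canonical chain is rerouted through (i , j) by peeling off the steps of `chain i j` with
  -- the step lemmas. If both parts had odd length, each would contain a unit step and the joined
  -- route would be one coin longer; the hypothesis excludes this.
  split : ∀ i i′ j j′ → Even (i + j) ⊎ Even (i′ + j′) →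
    chain (i + i′) (j + j′) ≈ chain i j ++ map (shift (at i j)) (links i′ j′)
  split 0 i′ 0 j′ _                =
      ≈-reflexive (cong (at 0 0 ∷_) (sym (shift-identity (links i′ j′))))
  split 0 i′ 1 j′ (inj₂ ev)        = stepv i′ j′ ev
  split 0 i′ (suc (suc j)) j′ ev   =
      ≈-trans (stepV i′ (j + j′)) (≈-trans (▹-cong (at 0 2) (split 0 i′ j j′ ev))
    (≈-reflexive (▹-++ 0 2 0 j (chain 0 j) (links i′ j′))))
  split 1 i′ 0 j′ (inj₂ ev)        = steph i′ j′ ev
  split 1 i′ (suc j) j′ ev         =
      ≈-trans (stepD i′ (j + j′)) (≈-trans (▹-cong (at 1 1) (split 0 i′ j j′ ev))
    (≈-reflexive (▹-++ 1 1 0 j (chain 0 j) (links i′ j′))))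
  split (suc (suc i)) i′ j j′ ev   = ≈-trans (▹-cong (at 2 0) (split i i′ j j′ ev))
    (≈-reflexive (▹-++ 2 0 i j (chain i j) (links i′ j′)))

  end∈chain : ∀ i j → at i j ∈ chain i j
  end∈chain 0 0             = here refl
  end∈chain 0 1             = there (here refl)
  end∈chain 0 (suc (suc j)) = there
      (subst (_∈ links 0 (2 + j)) (shift-at 0 2 0 j) (∈-map⁺ _ (end∈chain 0 j)))
  end∈chain 1 0             = there (here refl)
  end∈chain 1 (suc j)       = there
      (subst (_∈ links 1 (1 + j)) (shift-at 1 1 0 j) (∈-map⁺ _ (end∈chain 0 j)))
  end∈chain (suc (suc i)) j = there
      (subst (_∈ links (2 + i) j) (shift-at 2 0 i j) (∈-map⁺ _ (end∈chain i j)))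

  -- The swapped route takes its vertical double steps first; the step lemmas bring it back to the
  -- canonical order.
  chain-swap : ∀ r v → map swap (chain r v) ≈ chain v r
  chain-swap 0 0             = ≈-refl
  chain-swap 0 1             = ≈-refl
  chain-swap 0 (suc (suc v)) = ≈-trans
      (≈-reflexive (cong (at 0 0 ∷_) (trans (sym (map-∘ (chain 0 v))) (map-∘ (chain 0 v)))))
      (▹-cong (at 2 0) (chain-swap 0 v))
  chain-swap 1 0             = ≈-refl
  chain-swap 1 (suc v)       = ≈-trans
      (≈-trans (≈-reflexive (cong (at 0 0 ∷_)
      (trans (sym (map-∘ (chain 0 v))) (map-∘ (chain 0 v))))) (▹-cong (at 1 1) (chain-swap 0 v)))
      (≈-sym (stepD v 0))
  chain-swap (suc (suc r)) v = ≈-trans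
      (≈-trans (≈-reflexive (cong (at 0 0 ∷_)
      (trans (sym (map-∘ (chain r v))) (map-∘ (chain r v))))) (▹-cong (at 0 2) (chain-swap r v)))
      (≈-sym (stepV v r))

  -- Sliding a loose coin along a chain

  extract₂ : ∀ {e w : Position} {Y} → e ∈ Y → w ∈ Y → e ≢ w → ∃[ Z ] Y ↭ e ∷ w ∷ Z
  extract₂ {e} {w} e∈Y w∈Y e≢w with ys , zs , refl ← ∈-∃++ e∈Y
    with ∈-resp-↭ (↭-shift e ys zs) w∈Y
  ... | here refl = ⊥-elim (e≢w refl)
  ... | there w∈Z with ys′ , zs′ , eq ← ∈-∃++ w∈Z =
    ys′ ++ zs′ , ↭-trans (↭-shift e ys zs) (prep e (subst (_↭ _) (sym eq) (↭-shift w ys′ zs′)))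

  window : ∀ {e w d d′ Y} → e ∈ Y → w ∈ Y → e ≢ w →
    e ∷ w ∷ d ∷ [] ≈ e ∷ w ∷ d′ ∷ [] → Y ++ [ d ] ≈ Y ++ [ d′ ]
  window {e} {w} {d} {d′} {Y} e∈Y w∈Y e≢w block with Z , Y↭ ← extract₂ e∈Y w∈Y e≢w = begin
    Y ++ [ d ]                 ≈⟨ gather d ⟩
    (e ∷ w ∷ d ∷ []) ++ Z      ≈⟨ ≈-frame Z block ⟩
    (e ∷ w ∷ d′ ∷ []) ++ Z     ≈⟨ gather d′ ⟨
    Y ++ [ d′ ]                ∎
    where
    open ≈-Reasoning
    gather : ∀ d → Y ++ [ d ] ≈ (e ∷ w ∷ d ∷ []) ++ Z
    gather d = ≈-↭ (↭-trans (++⁺ʳ [ d ] Y↭) (prep e (prep w (++-comm Z [ d ]))))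

  at-injective₁ : ∀ {i j i′ j′} → at i j ≡ at i′ j′ → i ≡ i′
  at-injective₁ refl = refl

  module Sliding (h : ℕ)
    (slideHˡ : at 0 0 ∷ at 2 0 ∷ at 0 h ∷ [] ≈ at 0 0 ∷ at 2 0 ∷ at 1 h ∷ [])
    (slideHʳ : at 0 0 ∷ at 2 0 ∷ at 1 h ∷ [] ≈ at 0 0 ∷ at 2 0 ∷ at 2 h ∷ [])
    (slideh  : at 0 0 ∷ at 1 0 ∷ at 0 h ∷ [] ≈ at 0 0 ∷ at 1 0 ∷ at 1 h ∷ [])
    (slideD  : at 0 0 ∷ at 1 1 ∷ at 0 (1 + h) ∷ [] ≈ at 0 0 ∷ at 1 1 ∷ at 1 (1 + h) ∷ []) where

    slide-along : ∀ {X Y d d′} → X ≈ Y → Y ++ [ d ] ≈ Y ++ [ d′ ] → X ++ [ d ] ≈ X ++ [ d′ ]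
    slide-along X≈Y eq = ≈-trans (≈-frame _ X≈Y) (≈-trans eq (≈-sym (≈-frame _ X≈Y)))

    split-row : ∀ i i′ v → Even (i + v) ⊎ Even (i′ + 0) →
      chain (i + i′) v ≈ chain i v ++ map (shift (at i v)) (links i′ 0)
    split-row i i′ v ev = subst (λ w →
        chain (i + i′) w ≈ chain i v ++ map (shift (at i v)) (links i′ 0)) (ℕ.+-identityʳ v)
        (split i i′ v 0 ev)

    -- The loose coin is h rows above the top row of the chain. The chain is rerouted so that a step
    -- along its top row begins below the coin, if i + v is even, or has its midpoint there, if i +
    -- v is odd; then three coins suffice for a local exchange, after which the chain is restored.
    slide-step : ∀ i i′ v → chain (i + suc i′) v ++ [ at i (h + v) ] ≈ chain (i + suc i′) v
        ++ [ at (suc i) (h + v) ]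
    slide-step i i′ v with parity (i + v)
    slide-step i 0 v | inj₁ ev = slide-along (split-row i 1 v (inj₁ ev))
      (window (∈-++⁺ˡ (end∈chain i v)) (∈-++⁺ʳ (chain i v) (here refl))
          (λ eq → ℕ.1+n≢n (sym (at-injective₁ eq)))
        (≈-map (shift-isometry (at i v)) slideh))
    slide-step i (suc i′) v | inj₁ ev = slide-along (split-row i (2 + i′) v (inj₁ ev))
      (window (∈-++⁺ˡ (end∈chain i v)) (∈-++⁺ʳ (chain i v) (here refl))
          (λ eq → ℕ.m≢1+n+m i (at-injective₁ eq))
        (≈-map (shift-isometry (at i v)) slideHˡ))
    slide-step (suc i) i′ v | inj₂ ev rewrite sym (ℕ.+-suc i (suc i′)) =
        slide-along (split-row i (2 + i′) v (inj₁ ev))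
      (window (∈-++⁺ˡ (end∈chain i v)) (∈-++⁺ʳ (chain i v) (here refl))
          (λ eq → ℕ.m≢1+n+m i (at-injective₁ eq))
        (≈-map (shift-isometry (at i v)) slideHʳ))
    -- In column 0 there is no room for a step with its midpoint below the coin, so the chain climbs
    -- to the top row by a diagonal step from (0 , v) to (1 , v + 1).
    slide-step 0 i′ (suc v) | inj₂ ev rewrite ℕ.+-suc h v = slide-along
      (≈-trans (split-row 1 i′ (suc v) (inj₁ ev))
          (≈-frame _ (subst (λ w → chain 1 w ≈ chain 0 v ++ [ at 1 (1 + v) ]) (ℕ.+-comm v 1)
          (split 0 1 v 1 (inj₁ ev)))))
      (window (∈-++⁺ˡ (∈-++⁺ˡ (end∈chain 0 v))) (∈-++⁺ˡ (∈-++⁺ʳ (chain 0 v) (here refl))) (λ ())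
        (≈-map (shift-isometry (at 0 v)) slideD))

    slide : ∀ i i′ v → chain (i + i′) v ++ [ at i (h + v) ] ≈ chain (i + i′) v
        ++ [ at (i + i′) (h + v) ]
    slide i 0 v rewrite ℕ.+-identityʳ i = ≈-refl
    slide i (suc i′) v = ≈-trans (slide-step i i′ v)
      (subst (λ k → chain k v ++ [ at (suc i) (h + v) ] ≈ chain k v ++ [ at k (h + v) ])
          (sym (ℕ.+-suc i i′)) (slide (suc i) i′ v))

  open Sliding 1 slideHˡ₁ slideHʳ₁ slideh₁ slideD₁ public using () renaming (slide to slide₁)
  open Sliding 2 slideHˡ₂ slideHʳ₂ slideh₂ slideD₂ public using () renaming (slide to slide₂)

  chain-top₂ : ∀ r v → chain r (2 + v) ≈ chain r v ++ [ at r (2 + v) ]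
  chain-top₂ r v = subst₂ (λ r′ v′ → chain r′ v′ ≈ chain r v ++ [ at r (2 + v) ])
    (ℕ.+-identityʳ r) (ℕ.+-comm v 2) (split r 0 v 2 (inj₂ _))

  chain-right₂ : ∀ r v → chain (2 + r) v ≈ chain r v ++ [ at (2 + r) v ]
  chain-right₂ r v = subst₂ (λ r′ v′ → chain r′ v′ ≈ chain r v ++ [ at (2 + r) v ])
    (ℕ.+-comm r 2) (ℕ.+-identityʳ v) (split r 2 v 0 (inj₂ _))

  slide-right₂ : ∀ r v → chain r v ++ [ at (2 + r) 0 ] ≈ chain r v ++ [ at (2 + r) v ]
  slide-right₂ r v = ≈-trans (turn 0)
      (≈-trans (≈-map swap-isometry (slide₂ 0 v r)) (≈-sym (turn v)))
    where
    turn : ∀ j → chain r v ++ [ at (2 + r) j ] ≈ map swap (chain v r ++ [ at j (2 + r) ])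
    turn j = ≈-trans (≈-frame _ (≈-sym (chain-swap v r)))
        (≈-reflexive (sym (map-++ swap (chain v r) _)))

  -- The mirrored chain joins the other pair of opposite corners. By induction all of it but one end
  -- coin is returned to the usual diagonal; that coin then sits two columns or two rows beyond the
  -- rest, at the wrong end of its side, and slides to the right end. The only base case that needs
  -- a rearrangement is the 2 × 2 square.
  flip : ∀ r v → map (reflect (ℤ.+ r)) (chain r v) ≈ chain r v
  flip (suc (suc r)) v = begin
    map (reflect (ℤ.+ (2 + r))) (chain (2 + r) v)           ≡⟨ cong₂ _∷_ first rest ⟩
    at (2 + r) 0 ∷ map (reflect (ℤ.+ r)) (chain r v)        ≈⟨ ∷-cong _ (flip r v) ⟩
    at (2 + r) 0 ∷ chain r v                                ≈⟨ ≈-↭ (∷↭∷ʳ _ _) ⟩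
    chain r v ++ [ at (2 + r) 0 ]                           ≈⟨ slide-right₂ r v ⟩
    chain r v ++ [ at (2 + r) v ]                           ≈⟨ chain-right₂ r v ⟨
    chain (2 + r) v                                         ∎
    where
    open ≈-Reasoning
    move : ∀ r x → ℤ.+ 2 ℤ.+ r ℤ.- (x ℤ.+ ℤ.+ 2) ≡ r ℤ.- x
    move = ℤ.solve-∀
    first : reflect (ℤ.+ (2 + r)) (at 0 0) ≡ at (2 + r) 0
    first = cong (λ k → at k 0) (ℕ.+-identityʳ (2 + r))
    rest : map (reflect (ℤ.+ (2 + r))) (links (2 + r) v) ≡ map (reflect (ℤ.+ r)) (chain r v)
    rest = trans (sym (map-∘ (chain r v)))
      (map-cong (λ (x , y) → cong₂ _,_ (move (ℤ.+ r) x) (ℤ.+-identityʳ y)) (chain r v))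
  flip r (suc (suc v)) = begin
    map (reflect (ℤ.+ r)) (chain r (2 + v))
        ≈⟨ ≈-map (reflect-isometry (ℤ.+ r)) (chain-top₂ r v) ⟩
    map (reflect (ℤ.+ r)) (chain r v ++ [ at r (2 + v) ])   ≡⟨ map-++ _ (chain r v) _ ⟩
    map (reflect (ℤ.+ r)) (chain r v)
        ++ [ ℤ.+ r ℤ.- ℤ.+ r , ℤ.+ (2 + v) ]
        ≡⟨ cong (λ x → map (reflect (ℤ.+ r)) (chain r v) ++ [ x , ℤ.+ (2 + v) ])
        (ℤ.+-inverseʳ (ℤ.+ r)) ⟩
    map (reflect (ℤ.+ r)) (chain r v) ++ [ at 0 (2 + v) ]   ≈⟨ ≈-frame _ (flip r v) ⟩
    chain r v ++ [ at 0 (2 + v) ]                           ≈⟨ slide₂ 0 r v ⟩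
    chain r v ++ [ at r (2 + v) ]                           ≈⟨ chain-top₂ r v ⟨
    chain r (2 + v)                                         ∎
    where open ≈-Reasoning
  flip 0 0 = ≈-refl
  flip 0 1 = ≈-refl
  flip 1 0 = ≈-↭ (∷↭∷ʳ _ _)
  flip 1 1 = ≈-sym square-flip

  ≈↘-trans : ∀ {X Y Z} → X ≈ Y → Y ↘ Z → X ↘ Z
  ≈↘-trans (a , _) = ↘-trans a

  ↘≈-trans : ∀ {X Y Z} → X ↘ Y → Y ≈ Z → X ↘ Z
  ↘≈-trans a (b , _) = ↘-trans a b

  -- Absorbing a coin next to a chain

  chain-diag : ∀ r v → chain (1 + r) (1 + v) ≈ chain r v ++ [ at (1 + r) (1 + v) ]
  chain-diag r v = subst₂ (λ r′ v′ → chain r′ v′ ≈ chain r v ++ [ at (1 + r) (1 + v) ])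
    (ℕ.+-comm r 1) (ℕ.+-comm v 1) (split r 1 v 1 (inj₂ _))

  chain-top₁ : ∀ r v → Even (r + v) → chain r (1 + v) ≈ chain r v ++ [ at r (1 + v) ]
  chain-top₁ r v ev = subst₂ (λ r′ v′ → chain r′ v′ ≈ chain r v ++ [ at r (1 + v) ])
    (ℕ.+-identityʳ r) (ℕ.+-comm v 1) (split r 0 v 1 (inj₁ ev))

  chain-right₁ : ∀ r v → Even (r + v) → chain (1 + r) v ≈ chain r v ++ [ at (1 + r) v ]
  chain-right₁ r v ev = subst₂ (λ r′ v′ → chain r′ v′ ≈ chain r v ++ [ at (1 + r) v ])
    (ℕ.+-comm r 1) (ℕ.+-identityʳ v) (split r 1 v 0 (inj₁ ev))

  Exposed : Position → List Position → Set
  Exposed p Y = p ∈ Y ⊎ Supported p Y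

  expose : ∀ {c p X} → length X < c → Exposed p X → X ⇒[ c ] p ∷ X
  expose <c (inj₁ p∈X) = ⊆⇒ λ { (here refl) → p∈X ; (there q∈X) → q∈X }
  expose <c (inj₂ s)   = grow <c s ◅ ε

  -- To recover p, rearrange X into Y, let p appear, and return from Y to X with p as a bystander.
  -- The additional coin needed on the way back is the one by which X ++ [ p ] exceeds X.
  absorb-exposed : ∀ {X Y p} → X ≈ Y → Exposed p Y → X ++ [ p ] ↘ X
  absorb-exposed {X} {Y} {p} X≈Y exposed = reduction
    (≤-trans (ℕ.n≤1+n _) (≤-reflexive (sym 1+X)))
    (⊆⇒ ∈-++⁺ˡ)
    (cap-mono cap≤ (forth (to X≈Y) ◅◅
      expose (≤-trans (≤-reflexive (cong suc (sym (≈-length X≈Y)))) (ℕ.n≤1+n _)) exposed)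
      ◅◅ ⊆⇒ (∈-resp-↭ (++-comm Y [ p ]))
      ◅◅ cap-mono (≤-reflexive (trans (cong (3 +_) (sym (≈-length X≈Y))) (cong (2 +_) (sym 1+X))))
          (frame [ p ] (forth (from X≈Y))))
    where
    1+X : length (X ++ [ p ]) ≡ suc (length X)
    1+X = trans (length-++ X) (ℕ.+-comm (length X) 1)
    cap≤ : 2 + length X ≤ 2 + length (X ++ [ p ])
    cap≤ = s≤s (s≤s (≤-trans (ℕ.n≤1+n _) (≤-reflexive (sym 1+X))))

  between-horizontal : ∀ {i j Y} → at i j ∈ Y → at (2 + i) j ∈ Y → Supported (at (1 + i) j) Y
  between-horizontal l∈Y r∈Y = _ , _ , (λ ()) , here refl , there (here refl) , l∈Y , r∈Y

  between-vertical : ∀ {i j Y} → at i j ∈ Y → at i (2 + j) ∈ Y → Supported (at i (1 + j)) Y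
  between-vertical b∈Y t∈Y = _ , _ , (λ ()) , there (there (there (here refl))) , there
      (there (here refl)) , b∈Y , t∈Y

  above-corner : ∀ {i j Y} → at i j ∈ Y → at (1 + i) (1 + j) ∈ Y → Supported (at i (1 + j)) Y
  above-corner b∈Y t∈Y = _ , _ , (λ ()) , there (there (there (here refl))) , there (here refl) ,
      b∈Y , t∈Y

  below-corner : ∀ {i j Y} → at i j ∈ Y → at (1 + i) (1 + j) ∈ Y → Supported (at (1 + i) j) Y
  below-corner b∈Y t∈Y = _ , _ , (λ ()) , here refl , there (there (here refl)) , b∈Y , t∈Y

  last∈ : ∀ X {p : Position} → p ∈ X ++ [ p ]
  last∈ X = ∈-++⁺ʳ X (here refl)

  -- If the parity permits, the chain is routed through (i , j). Otherwise (i , j) is at odd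
  -- distance from both ends, and the chain is routed around it: (i , j) is either the midpoint of a
  -- double step or beside a diagonal step, so two of its neighbors carry coins.
  exposing : ∀ i i′ j j′ → ∃[ Y ] chain (i + i′) (j + j′) ≈ Y × Exposed (at i j) Y
  exposing i i′ j j′ with parity (i + j) | parity (i′ + j′)
  ... | inj₁ ev | _       = _ , split i i′ j j′ (inj₁ ev) , inj₁ (∈-++⁺ˡ (end∈chain i j))
  ... | inj₂ _  | inj₁ ev = _ , split i i′ j j′ (inj₂ ev) , inj₁ (∈-++⁺ˡ (end∈chain i j))
  exposing (suc i) (suc i′) j j′ | inj₂ ev | inj₂ _ =
    _ , subst (λ r → chain r (j + j′) ≈ (chain i j ++ [ at (2 + i) j ])
        ++ map (shift (at (2 + i) j)) (links i′ j′)) (cong suc (sym (ℕ.+-suc i i′)))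
          (≈-trans (split (2 + i) i′ j j′ (inj₁ ev)) (≈-frame _ (chain-right₂ i j)))
      , inj₂ (between-horizontal (∈-++⁺ˡ (∈-++⁺ˡ (end∈chain i j))) (∈-++⁺ˡ (last∈ (chain i j))))
  exposing i i′ (suc j) (suc j′) | inj₂ ev | inj₂ _ =
    _ , subst (λ v → chain (i + i′) v ≈ (chain i j ++ [ at i (2 + j) ])
        ++ map (shift (at i (2 + j))) (links i′ j′)) (cong suc (sym (ℕ.+-suc j j′)))
          (≈-trans (split i i′ (2 + j) j′ (inj₁ (subst Even (sym (ℕ.+-suc i (suc j))) ev)))
              (≈-frame _ (chain-top₂ i j)))
      , inj₂ (between-vertical (∈-++⁺ˡ (∈-++⁺ˡ (end∈chain i j))) (∈-++⁺ˡ (last∈ (chain i j))))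
  -- Here (i , j) is the upper left corner, so no double step has it as midpoint; a diagonal step
  -- cuts off the corner. The next case is the lower right corner.
  exposing 0 (suc i′) (suc j) 0 | inj₂ ev | inj₂ _ =
    _ , ≈-trans (split 1 i′ (suc j) 0 (inj₁ ev)) (≈-frame _ (chain-diag 0 j))
      , inj₂ (above-corner (∈-++⁺ˡ (∈-++⁺ˡ (end∈chain 0 j))) (∈-++⁺ˡ (last∈ (chain 0 j))))
  exposing (suc i) 0 0 (suc j′) | inj₂ ev | inj₂ _ =
    _ , ≈-trans (split (suc i) 0 1 j′
        (inj₁ (subst Even (sym (ℕ.+-comm (suc i) 1))
        (subst (λ n → Even (suc (suc n))) (ℕ.+-identityʳ i) ev)))) (≈-frame _ (chain-diag i 0))
      , inj₂ (below-corner (∈-++⁺ˡ (∈-++⁺ˡ (end∈chain i 0))) (∈-++⁺ˡ (last∈ (chain i 0))))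
  exposing 0 _ 0 _ | inj₂ () | _
  exposing _ 0 _ 0 | _ | inj₂ ()

  absorb-inside : ∀ i i′ j j′ → chain (i + i′) (j + j′) ++ [ at i j ] ↘ chain (i + i′) (j + j′)
  absorb-inside i i′ j j′ with _ , ≈Y , exposed ← exposing i i′ j j′ = absorb-exposed ≈Y exposed

  -- When r + v is odd, the top coin of the chain can be moved up a row without spending a coin.
  odd-top : ∀ r v → Even (suc (r + v)) → ∃[ Z ] ∃[ m ] chain r v ≈ Z ++ [ m ]
    × chain r (1 + v) ≈ Z ++ [ at r (1 + v) ] × Supported m (Z ++ [ at r (1 + v) ])
  odd-top r (suc v) ev = chain r v , at r (1 + v) , chain-top₁ r v
      (subst Even (cong suc (ℕ.+-suc r v)) ev) , chain-top₂ r v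
    , between-vertical (∈-++⁺ˡ (end∈chain r v)) (last∈ (chain r v))
  odd-top (suc r) 0 ev = chain r 0 , at (1 + r) 0 , chain-right₁ r 0 ev , chain-diag r 0
    , below-corner (∈-++⁺ˡ (end∈chain r 0)) (last∈ (chain r 0))

  swap-last : ∀ (Z : List Position) p q → (Z ++ [ p ]) ++ [ q ] ↭ (Z ++ [ q ]) ++ [ p ]
  swap-last Z p q = ↭-trans (↭-reflexive (++-assoc Z _ _))
      (↭-trans (++⁺ˡ Z (++-comm [ p ] [ q ])) (↭-reflexive (sym (++-assoc Z _ _))))

  absorb-top₁ : ∀ i i′ v → chain (i + i′) v ++ [ at i (1 + v) ] ↘ chain (i + i′) (1 + v)
  absorb-top₁ i i′ v = ≈↘-trans (slide₁ i i′ v) corner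
    where
    r = i + i′
    corner : chain r v ++ [ at r (1 + v) ] ↘ chain r (1 + v)
    corner with parity (r + v)
    ... | inj₁ ev = from (chain-top₁ r v ev)
    -- For odd r + v the taller chain has no more coins than the old one. The new coin takes over
    -- the role of m, which then has two neighbors in the taller chain and is absorbed.
    ... | inj₂ ev with Z , m , ≈m , ≈d , s ← odd-top r v ev =
      ≈↘-trans (≈-trans (≈-frame _ ≈m) (≈-↭ (swap-last Z m _)))
               (↘≈-trans (absorb-exposed ≈-refl (inj₂ s)) (≈-sym ≈d))

  absorb-top₂ : ∀ i i′ v → chain (i + i′) v ++ [ at i (2 + v) ] ↘ chain (i + i′) (2 + v)
  absorb-top₂ i i′ v = to (≈-trans (slide₂ i i′ v) (≈-sym (chain-top₂ (i + i′) v)))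

  -- There is no way back, since the top row is outside the span of the lower chain. For odd r + v
  -- nothing can simply be dropped: the last coin m of the lower chain is first placed, then the top
  -- coin is forgotten.
  remove-top : ∀ r v → chain r (1 + v) ⇒[ 2 + length (chain r (1 + v)) ] chain r v
  remove-top r v with parity (r + v)
  ... | inj₁ ev = forth (to (chain-top₁ r v ev)) ◅◅ ⊆⇒ ∈-++⁺ˡ
  ... | inj₂ ev with Z , m , ≈m , ≈d , s ← odd-top r v ev =
    forth (to ≈d) ◅◅ cap-mono (≤-reflexive (cong (2 +_) (sym (≈-length ≈d))))
      ((grow (ℕ.n≤1+n _) s ◅ ε) ◅◅ ⊆⇒ ⊆m)
    ◅◅ cap-mono (≤-reflexive (cong (2 +_) lengths)) (forth (from ≈m))
    where
    ⊆m : ∀ {p} → p ∈ Z ++ [ m ] → p ∈ m ∷ (Z ++ [ at r (1 + v) ])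
    ⊆m p∈ with ∈-resp-↭ (++-comm Z [ m ]) p∈
    ... | here eq   = here eq
    ... | there p∈Z = there (∈-++⁺ˡ p∈Z)
    lengths : length (Z ++ [ m ]) ≡ length (chain r (1 + v))
    lengths = trans (trans (length-++ Z) (sym (length-++ Z))) (sym (≈-length ≈d))

  -- Rectangles

  record Rect : Set where
    constructor rect
    field
      left bottom  : ℤ
      width height : ℕ

  open Rect public

  -- A rectangle has suc width columns and suc height rows.
  cells : Rect → PositionSet
  cells (rect l b w h) (x , y) = (l ℤ.≤ x × x ℤ.≤ ℤ.+ w ℤ.+ l) × (b ℤ.≤ y × y ℤ.≤ ℤ.+ h ℤ.+ b)

  corner : Rect → Position
  corner R = left R , bottom R

  skeleton : Rect → List Position
  skeleton R = map (shift (corner R)) (chain (width R) (height R))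

  infix 4 _⊑_

  _⊑_ : Rect → Rect → Set
  Q ⊑ R = ∀ {p} → cells Q p → cells R p

  interval-offset : ∀ {l x w} → l ℤ.≤ x → x ℤ.≤ ℤ.+ w ℤ.+ l →
    ∃[ i ] ∃[ i′ ] x ≡ ℤ.+ i ℤ.+ l × i + i′ ≡ w
  interval-offset {l} {x} {w} l≤x x≤ = ℤ.∣ x ℤ.- l ∣ , ℤ.∣ ℤ.+ w ℤ.+ l ℤ.- x ∣
    , trans (cancel x l) (cong (ℤ._+ l) (sym i≡))
    , ℤ.+-injective (trans (cong₂ ℤ._+_ i≡ (ℤ.0≤i⇒+∣i∣≡i (ℤ.i≤j⇒0≤j-i x≤))) (total x l (ℤ.+ w)))
    where
    i≡ = ℤ.0≤i⇒+∣i∣≡i (ℤ.i≤j⇒0≤j-i l≤x)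
    cancel : ∀ x l → x ≡ x ℤ.- l ℤ.+ l
    cancel = ℤ.solve-∀
    total : ∀ x l w → x ℤ.- l ℤ.+ (w ℤ.+ l ℤ.- x) ≡ w
    total = ℤ.solve-∀

  interval-inside : ∀ {i w} l → i ≤ w → l ℤ.≤ ℤ.+ i ℤ.+ l × ℤ.+ i ℤ.+ l ℤ.≤ ℤ.+ w ℤ.+ l
  interval-inside {i} l i≤w = subst (ℤ._≤ ℤ.+ i ℤ.+ l) (ℤ.+-identityˡ l) (ℤ.+-monoˡ-≤ l (ℤ.+≤+ z≤n))
    , ℤ.+-monoˡ-≤ l (ℤ.+≤+ i≤w)

  cell-inside : ∀ {i j} R → i ≤ width R → j ≤ height R → cells R (shift (corner R) (at i j))
  cell-inside R i≤ j≤ = interval-inside (left R) i≤ , interval-inside (bottom R) j≤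

  -- A view of a cell of a rectangle: matching on it turns width and height into the sums i + i′ and
  -- j + j′, the form in which chains are split.
  data Offsets : Rect → Position → Set where
    offsets : ∀ l b i i′ j j′ → Offsets (rect l b (i + i′) (j + j′)) (shift (l , b) (at i j))

  cell-offsets : ∀ {R p} → cells R p → Offsets R p
  cell-offsets {rect l b w h} ((l≤ , ≤r) , (b≤ , ≤t))
    with i , i′ , refl , refl ← interval-offset l≤ ≤r
    with j , j′ , refl , refl ← interval-offset b≤ ≤t = offsets l b i i′ j j′

  ⊑-same-corner : ∀ {l b w w′ h h′} → w ≤ w′ → h ≤ h′ → rect l b w h ⊑ rect l b w′ h′
  ⊑-same-corner {l} {b} w≤ h≤ ((l≤ , ≤r) , (b≤ , ≤t)) =
    (l≤ , ℤ.≤-trans ≤r (ℤ.+-monoˡ-≤ l (ℤ.+≤+ w≤))) , (b≤ , ℤ.≤-trans ≤t (ℤ.+-monoˡ-≤ b (ℤ.+≤+ h≤)))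

  -- Symmetries of the grid

  -- The instances `diagonal` and `mirror` reduce all directions to one. Chains are preserved only
  -- up to `_≈_`, because `mirror` puts a chain on the other diagonal; `flip` repairs this.
  record Symmetry : Set where
    field
      σ          : Position → Position
      σᴿ         : Rect → Rect
      isometry   : IsIsometry σ
      involutive : ∀ p → σ (σ p) ≡ p
      involutiveᴿ : ∀ R → σᴿ (σᴿ R) ≡ R
      σ-cells    : ∀ {R p} → cells R p → cells (σᴿ R) (σ p)
      σ-skeleton : ∀ R → map σ (skeleton R) ≈ skeleton (σᴿ R)

    map-involutive : ∀ X → map σ (map σ X) ≡ X
    map-involutive X = trans (sym (map-∘ X)) (trans (map-cong involutive X) (map-id X))

  diagonal : Symmetry
  diagonal = record
    { σ = swap
    ; σᴿ = λ (rect l b w h) → rect b l h w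
    ; isometry = swap-isometry
    ; involutive = λ _ → refl
    ; involutiveᴿ = λ _ → refl
    ; σ-cells = swap
    ; σ-skeleton = λ (rect l b w h) → ≈-trans
        (≈-reflexive (trans (sym (map-∘ (chain w h))) (map-∘ (chain w h))))
        (≈-map (shift-isometry (b , l)) (chain-swap w h))
    }

  mirror : Symmetry
  mirror = record
    { σ = reflect ℤ.0ℤ
    ; σᴿ = λ (rect l b w h) → rect (ℤ.- (ℤ.+ w ℤ.+ l)) b w h
    ; isometry = reflect-isometry ℤ.0ℤ
    ; involutive = λ (x , y) → cong (_, y) (twice x)
    ; involutiveᴿ = λ (rect l b w h) → cong (λ l → rect l b w h) (twiceᴿ (ℤ.+ w) l)
    ; σ-cells = reflected
    ; σ-skeleton = λ (rect l b w h) → ≈-trans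
        (≈-reflexive (trans (sym (map-∘ (chain w h)))
          (trans (map-cong (λ (x , y) → cong (_, y ℤ.+ b) (turn (ℤ.+ w) l x)) (chain w h))
              (map-∘ (chain w h)))))
        (≈-map (shift-isometry (ℤ.- (ℤ.+ w ℤ.+ l) , b)) (flip w h))
    }
    where
    edge : ∀ w l → ℤ.- l ≡ w ℤ.+ (ℤ.- (w ℤ.+ l))
    edge = ℤ.solve-∀
    reflected : ∀ {R p} → cells R p →
      cells (rect (ℤ.- (ℤ.+ width R ℤ.+ left R)) (bottom R) (width R) (height R)) (reflect ℤ.0ℤ p)
    reflected {rect l b w h} {x , y} ((l≤x , x≤r) , ys) =
      ( subst (ℤ.- (ℤ.+ w ℤ.+ l) ℤ.≤_) (sym (ℤ.+-identityˡ (ℤ.- x))) (ℤ.neg-mono-≤ x≤r)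
      , subst₂ ℤ._≤_ (sym (ℤ.+-identityˡ (ℤ.- x))) (edge (ℤ.+ w) l) (ℤ.neg-mono-≤ l≤x)) , ys
    twice : ∀ x → ℤ.0ℤ ℤ.- (ℤ.0ℤ ℤ.- x) ≡ x
    twice = ℤ.solve-∀
    twiceᴿ : ∀ w l → ℤ.- (w ℤ.+ (ℤ.- (w ℤ.+ l))) ≡ l
    twiceᴿ = ℤ.solve-∀
    turn : ∀ w l x → ℤ.0ℤ ℤ.- (x ℤ.+ l) ≡ w ℤ.- x ℤ.+ (ℤ.- (w ℤ.+ l))
    turn = ℤ.solve-∀

  -- The 13 vectors with absolute coordinates summing to at most 2. Two neighbors of one position
  -- always differ by such a vector, so rectangles farther apart than this cannot interact.
  data Offset : Set where
    stay N₁ E₁ S₁ W₁ N₂ E₂ S₂ W₂ NE NW SE SW : Offset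

  vec : Offset → Position
  vec stay = ℤ.+ 0 , ℤ.+ 0
  vec N₁   = ℤ.+ 0 , ℤ.+ 1
  vec E₁   = ℤ.+ 1 , ℤ.+ 0
  vec S₁   = ℤ.+ 0 , ℤ.-[1+ 0 ]
  vec W₁   = ℤ.-[1+ 0 ] , ℤ.+ 0
  vec N₂   = ℤ.+ 0 , ℤ.+ 2
  vec E₂   = ℤ.+ 2 , ℤ.+ 0
  vec S₂   = ℤ.+ 0 , ℤ.-[1+ 1 ]
  vec W₂   = ℤ.-[1+ 1 ] , ℤ.+ 0
  vec NE   = ℤ.+ 1 , ℤ.+ 1
  vec NW   = ℤ.-[1+ 0 ] , ℤ.+ 1
  vec SE   = ℤ.+ 1 , ℤ.-[1+ 0 ]
  vec SW   = ℤ.-[1+ 0 ] , ℤ.-[1+ 0 ]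

  opposite : Offset → Offset
  opposite stay = stay
  opposite N₁   = S₁
  opposite E₁   = W₁
  opposite S₁   = N₁
  opposite W₁   = E₁
  opposite N₂   = S₂
  opposite E₂   = W₂
  opposite S₂   = N₂
  opposite W₂   = E₂
  opposite NE   = SW
  opposite NW   = SE
  opposite SE   = NW
  opposite SW   = NE

  infixl 6 _⊕_

  _⊕_ : Position → Offset → Position
  p ⊕ δ = shift p (vec δ)

  ⊕-⊕ : ∀ p α β δ → shift (vec α) (vec β) ≡ vec δ → (p ⊕ α) ⊕ β ≡ p ⊕ δ
  ⊕-⊕ p α β δ eq = trans (cong₂ _,_ (sym (ℤ.+-assoc (proj₁ (vec β)) _ _))
      (sym (ℤ.+-assoc (proj₂ (vec β)) _ _))) (cong (shift p) eq)

  ⊕-stay : ∀ p → p ⊕ stay ≡ p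
  ⊕-stay p = cong₂ _,_ (ℤ.+-identityˡ _) (ℤ.+-identityˡ _)

  ⊕-staypposite : ∀ p δ → (p ⊕ δ) ⊕ opposite δ ≡ p
  ⊕-staypposite p δ = trans (⊕-⊕ p δ (opposite δ) stay (cancel δ)) (⊕-stay p)
    where
    cancel : ∀ δ → shift (vec δ) (vec (opposite δ)) ≡ vec stay
    cancel stay = refl
    cancel N₁   = refl
    cancel E₁   = refl
    cancel S₁   = refl
    cancel W₁   = refl
    cancel N₂   = refl
    cancel E₂   = refl
    cancel S₂   = refl
    cancel W₂   = refl
    cancel NE   = refl
    cancel NW   = refl
    cancel SE   = refl
    cancel SW   = refl

  shift-at-⊕ : ∀ a i j p q → shift (shift a (at i j)) (at p q) ≡ shift a (at (p + i) (q + j))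
  shift-at-⊕ a i j p q = cong₂ _,_ (sym (ℤ.+-assoc (ℤ.+ p) (ℤ.+ i) (proj₁ a)))
      (sym (ℤ.+-assoc (ℤ.+ q) (ℤ.+ j) (proj₂ a)))

  -- Absorbing a coin near a rectangle

  -- That R′ contains R and d is all that is needed; conversely, R′ lies in the span of R and d
  -- because its chain is reached from them.
  Extends : Rect → Position → Set
  Extends R d = ∃[ R′ ] R ⊑ R′ × cells R′ d × skeleton R ++ [ d ] ↘ skeleton R′

  extends-by : ∀ l b {r v r′ v′ x y} → r ≤ r′ → v ≤ v′ → x ≤ r′ → y ≤ v′ →
    chain r v ++ [ at x y ] ↘ chain r′ v′ → Extends (rect l b r v) (shift (l , b) (at x y))
  extends-by l b {r} {v} {r′} {v′} r≤ v≤ x≤ y≤ red = rect l b r′ v′ , ⊑-same-corner r≤ v≤ ,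
    cell-inside (rect l b r′ v′) x≤ y≤ ,
    subst (_↘ skeleton (rect l b r′ v′)) (map-++ (shift (l , b)) (chain r v) _)
        (↘-map (shift-isometry (l , b)) red)

  extends-inside : ∀ {R d} → cells R d → Extends R d
  extends-inside d∈R with offsets l b i i′ j j′ ← cell-offsets d∈R =
    extends-by l b ≤-refl ≤-refl (ℕ.m≤m+n i i′) (ℕ.m≤m+n j j′) (absorb-inside i i′ j j′)

  module _ (τ : Symmetry) where
    open Symmetry τ

    map-σ-++ : ∀ R X → skeleton R ++ X ≈ map σ (skeleton (σᴿ R) ++ map σ X)
    map-σ-++ R X = ≈-trans (≈-reflexive (sym (map-involutive _)))
      (≈-trans (≈-reflexive (cong (map σ) (map-++ σ (skeleton R) X)))
        (≈-map isometry (≈-frame (map σ X) (σ-skeleton R))))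

    skeleton-σ : ∀ R → map σ (skeleton (σᴿ R)) ≈ skeleton R
    skeleton-σ R = ≈-trans (≈-map isometry (≈-sym (σ-skeleton R))) (≈-reflexive (map-involutive _))

    cells-σ⁻ : ∀ {R p} → cells R (σ p) → cells (σᴿ R) p
    cells-σ⁻ {R} {p} σp∈R = subst (cells (σᴿ R)) (involutive p) (σ-cells σp∈R)

    extends-sym : ∀ {R d} → Extends (σᴿ R) (σ d) → Extends R d
    extends-sym {R} {d} (R′ , ⊑R′ , d∈R′ , red) =
        σᴿ R′ , (λ p∈R → cells-σ⁻ (⊑R′ (σ-cells p∈R))) , cells-σ⁻ d∈R′
      , ≈↘-trans (map-σ-++ R [ d ]) (↘≈-trans (↘-map isometry red) (σ-skeleton R′))

    extends-⊕-sym : ∀ {δ δ′} → (∀ p → σ (p ⊕ δ) ≡ σ p ⊕ δ′) →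
      (∀ {R p} → cells R p → Extends R (p ⊕ δ′)) → ∀ {R p} → cells R p → Extends R (p ⊕ δ)
    extends-⊕-sym σ-⊕ ext {R} {p} p∈R =
        extends-sym (subst (Extends (σᴿ R)) (sym (σ-⊕ p)) (ext (σ-cells p∈R)))

  reflect-⊕ : ∀ {δ δ′} → ℤ.- proj₁ (vec δ) ≡ proj₁ (vec δ′) → proj₂ (vec δ) ≡ proj₂ (vec δ′) →
    ∀ p → reflect ℤ.0ℤ (p ⊕ δ) ≡ reflect ℤ.0ℤ p ⊕ δ′
  reflect-⊕ {δ} eq₁ eq₂ (x , y) = cong₂ _,_
    (trans (negate (proj₁ (vec δ)) x) (cong (ℤ._+ (ℤ.0ℤ ℤ.- x)) eq₁)) (cong (ℤ._+ y) eq₂)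
    where
    negate : ∀ d x → ℤ.0ℤ ℤ.- (d ℤ.+ x) ≡ ℤ.- d ℤ.+ (ℤ.0ℤ ℤ.- x)
    negate = ℤ.solve-∀

  extends-n : ∀ {R p} → cells R p → Extends R (p ⊕ N₁)
  extends-n p∈R with cell-offsets p∈R
  ... | offsets l b i i′ j 0 = subst₂ (λ v d → Extends (rect l b (i + i′) v) d)
    (sym (ℕ.+-identityʳ j)) (sym (shift-at-⊕ (l , b) i j 0 1))
    (extends-by l b ≤-refl (ℕ.n≤1+n j) (ℕ.m≤m+n i i′) ≤-refl (absorb-top₁ i i′ j))
  ... | offsets l b i i′ j (suc j′) = extends-inside (subst (cells (rect l b (i + i′) (j + suc j′)))
    (sym (shift-at-⊕ (l , b) i j 0 1)) (cell-inside (rect l b (i + i′) (j + suc j′)) (ℕ.m≤m+n i i′)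
      (≤-trans (s≤s (ℕ.m≤m+n j j′)) (≤-reflexive (sym (ℕ.+-suc j j′))))))

  extends-nn : ∀ {R p} → cells R p → Extends R (p ⊕ N₂)
  extends-nn {R} {p} p∈R with cell-offsets p∈R
  ... | offsets l b i i′ j 0 = subst₂ (λ v d → Extends (rect l b (i + i′) v) d)
    (sym (ℕ.+-identityʳ j)) (sym (shift-at-⊕ (l , b) i j 0 2))
    (extends-by l b ≤-refl (ℕ.m≤n+m j 2) (ℕ.m≤m+n i i′) ≤-refl (absorb-top₂ i i′ j))
  ... | offsets l b i i′ j (suc j′) = subst (Extends _) (⊕-⊕ p N₁ N₁ N₂ refl)
    (extends-n (subst (cells (rect l b (i + i′) (j + suc j′)))
      (sym (shift-at-⊕ (l , b) i j 0 1))
          (cell-inside (rect l b (i + i′) (j + suc j′)) (ℕ.m≤m+n i i′)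
        (≤-trans (s≤s (ℕ.m≤m+n j j′)) (≤-reflexive (sym (ℕ.+-suc j j′)))))))

  extends-e : ∀ {R p} → cells R p → Extends R (p ⊕ E₁)
  extends-e = extends-⊕-sym diagonal {E₁} {N₁} (λ _ → refl) extends-n

  -- Unless p is the upper right corner, its right or its upper neighbor is in R, and the target is
  -- only a unit step away from that cell.
  extends-ne : ∀ {R p} → cells R p → Extends R (p ⊕ NE)
  extends-ne {R} {p} p∈R with cell-offsets p∈R
  ... | offsets l b i 0 j 0 = subst₂ Extends
    (cong₂ (rect l b) (sym (ℕ.+-identityʳ i)) (sym (ℕ.+-identityʳ j)))
        (sym (shift-at-⊕ (l , b) i j 1 1))
    (extends-by l b (ℕ.n≤1+n i) (ℕ.n≤1+n j) ≤-refl ≤-refl (from (chain-diag i j)))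
  ... | offsets l b i (suc i′) j j′ = subst (Extends _) (⊕-⊕ p E₁ N₁ NE refl)
    (extends-n (subst (cells (rect l b (i + suc i′) (j + j′)))
      (sym (shift-at-⊕ (l , b) i j 1 0)) (cell-inside (rect l b (i + suc i′) (j + j′))
        (≤-trans (s≤s (ℕ.m≤m+n i i′)) (≤-reflexive (sym (ℕ.+-suc i i′)))) (ℕ.m≤m+n j j′))))
  ... | offsets l b i i′ j (suc j′) = subst (Extends _) (⊕-⊕ p N₁ E₁ NE refl)
    (extends-e (subst (cells (rect l b (i + i′) (j + suc j′)))
      (sym (shift-at-⊕ (l , b) i j 0 1))
          (cell-inside (rect l b (i + i′) (j + suc j′)) (ℕ.m≤m+n i i′)
        (≤-trans (s≤s (ℕ.m≤m+n j j′)) (≤-reflexive (sym (ℕ.+-suc j j′)))))))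

  extends-w : ∀ {R p} → cells R p → Extends R (p ⊕ W₁)
  extends-w = extends-⊕-sym mirror {W₁} {E₁} (reflect-⊕ {W₁} {E₁} refl refl) extends-e

  extends-ww : ∀ {R p} → cells R p → Extends R (p ⊕ W₂)
  extends-ww = extends-⊕-sym mirror {W₂} {E₂} (reflect-⊕ {W₂} {E₂} refl refl)
    (extends-⊕-sym diagonal {E₂} {N₂} (λ _ → refl) extends-nn)

  extends-nw : ∀ {R p} → cells R p → Extends R (p ⊕ NW)
  extends-nw = extends-⊕-sym mirror {NW} {NE} (reflect-⊕ {NW} {NE} refl refl) extends-ne

  extends-se : ∀ {R p} → cells R p → Extends R (p ⊕ SE)
  extends-se = extends-⊕-sym diagonal {SE} {NW} (λ _ → refl) extends-nw

  extends : ∀ δ {R p} → cells R p → Extends R (p ⊕ δ)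
  extends stay {R} {p} p∈R = subst (Extends R) (sym (⊕-stay p)) (extends-inside p∈R)
  extends N₁  = extends-n
  extends E₁  = extends-e
  extends S₁  = extends-⊕-sym diagonal {S₁} {W₁} (λ _ → refl) extends-w
  extends W₁  = extends-w
  extends N₂ = extends-nn
  extends E₂ = extends-⊕-sym diagonal {E₂} {N₂} (λ _ → refl) extends-nn
  extends S₂ = extends-⊕-sym diagonal {S₂} {W₂} (λ _ → refl) extends-ww
  extends W₂ = extends-ww
  extends NE = extends-ne
  extends NW = extends-nw
  extends SE = extends-se
  extends SW = extends-⊕-sym mirror {SW} {SE} (reflect-⊕ {SW} {SE} refl refl) extends-se

  -- Shrinking a rectangle

  -- One direction only, in contrast to `_↘_`: a rectangle is closed, so a chain in a smaller
  -- rectangle never leaves it.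
  record Shrinks (R R′ : Rect) : Set where
    constructor shrinking
    field
      fewer : length (skeleton R′) ≤ length (skeleton R)
      drop  : skeleton R ⇒[ 2 + length (skeleton R) ] skeleton R′

  open Shrinks public

  shrinks-refl : ∀ {R} → Shrinks R R
  shrinks-refl = shrinking ≤-refl ε

  shrinks-trans : ∀ {P Q R} → Shrinks P Q → Shrinks Q R → Shrinks P R
  shrinks-trans (shrinking l₁ d₁) (shrinking l₂ d₂) =
    shrinking (≤-trans l₂ l₁) (d₁ ◅◅ cap-mono (ℕ.+-monoʳ-≤ 2 l₁) d₂)

  shrinks-sym : ∀ τ {R R′} → Shrinks (Symmetry.σᴿ τ R) (Symmetry.σᴿ τ R′) → Shrinks R R′
  shrinks-sym τ {R} {R′} (shrinking l d) = shrinking l′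
    (forth (from (skeleton-σ τ R))
      ◅◅ cap-mono (≤-reflexive (cong (2 +_) (size R))) (map-⇒ isometry d)
      ◅◅ cap-mono (ℕ.+-monoʳ-≤ 2 l′) (back (from (skeleton-σ τ R′))))
    where
    open Symmetry τ
    size : ∀ R → length (skeleton (σᴿ R)) ≡ length (skeleton R)
    size R = trans (sym (length-map σ (skeleton (σᴿ R)))) (≈-length (skeleton-σ τ R))
    l′ : length (skeleton R′) ≤ length (skeleton R)
    l′ = subst₂ _≤_ (size R′) (size R) l

  shrinks-top : ∀ l b r v → Shrinks (rect l b r (1 + v)) (rect l b r v)
  shrinks-top l b r v = shrinking
    (subst₂ _≤_ (sym (length-map _ (chain r v))) (sym (length-map _ (chain r (1 + v)))) fewer₀)
    (subst (λ k → skeleton (rect l b r (1 + v)) ⇒[ 2 + k ] skeleton (rect l b r v))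
        (sym (length-map _ (chain r (1 + v))))
      (map-⇒ (shift-isometry (l , b)) (remove-top r v)))
    where
    length-∷ʳ : ∀ (Z : List Position) {p q} → length (Z ++ [ p ]) ≡ length (Z ++ [ q ])
    length-∷ʳ Z = trans (length-++ Z) (sym (length-++ Z))
    fewer₀ : length (chain r v) ≤ length (chain r (1 + v))
    fewer₀ with parity (r + v)
    ... | inj₁ ev = ≤-trans (ℕ.m≤m+n _ 1)
        (≤-reflexive (sym (trans (≈-length (chain-top₁ r v ev)) (length-++ (chain r v)))))
    ... | inj₂ ev with Z , m , ≈m , ≈d , s ← odd-top r v ev =
      ≤-reflexive (trans (≈-length ≈m) (trans (length-∷ʳ Z) (sym (≈-length ≈d))))

  shrinks-right : ∀ l b r v → Shrinks (rect l b (1 + r) v) (rect l b r v)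
  shrinks-right l b r v = shrinks-sym diagonal (shrinks-top b l v r)

  shrinks-left : ∀ l b r v → Shrinks (rect l b (1 + r) v) (rect (ℤ.1ℤ ℤ.+ l) b r v)
  shrinks-left l b r v = shrinks-sym mirror
    (subst (λ x → Shrinks (rect (ℤ.- (ℤ.+ (1 + r) ℤ.+ l)) b (1 + r) v) (rect x b r v))
        (edge (ℤ.+ r) l)
      (shrinks-right _ b r v))
    where
    edge : ∀ r l → ℤ.- (ℤ.1ℤ ℤ.+ r ℤ.+ l) ≡ ℤ.- (r ℤ.+ (ℤ.1ℤ ℤ.+ l))
    edge = ℤ.solve-∀

  shrinks-rights : ∀ l b i′ r v → Shrinks (rect l b (r + i′) v) (rect l b r v)
  shrinks-rights l b 0 r v = subst (λ k → Shrinks (rect l b k v) (rect l b r v))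
      (sym (ℕ.+-identityʳ r)) shrinks-refl
  shrinks-rights l b (suc i′) r v =
      subst (λ k → Shrinks (rect l b k v) (rect l b r v)) (sym (ℕ.+-suc r i′))
    (shrinks-trans (shrinks-right l b (r + i′) v) (shrinks-rights l b i′ r v))

  shrinks-lefts : ∀ l b i r v → Shrinks (rect l b (i + r) v) (rect (ℤ.+ i ℤ.+ l) b r v)
  shrinks-lefts l b 0 r v = subst (λ x → Shrinks (rect l b r v) (rect x b r v))
      (sym (ℤ.+-identityˡ l)) shrinks-refl
  shrinks-lefts l b (suc i) r v = shrinks-trans (shrinks-left l b (i + r) v)
    (subst (λ x → Shrinks (rect (ℤ.1ℤ ℤ.+ l) b (i + r) v) (rect x b r v)) (edge (ℤ.+ i) l)
        (shrinks-lefts (ℤ.1ℤ ℤ.+ l) b i r v))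
    where
    edge : ∀ i l → i ℤ.+ (ℤ.1ℤ ℤ.+ l) ≡ ℤ.1ℤ ℤ.+ i ℤ.+ l
    edge = ℤ.solve-∀

  shrinks-horizontally : ∀ l b i i′ r v →
      Shrinks (rect l b (i + (r + i′)) v) (rect (ℤ.+ i ℤ.+ l) b r v)
  shrinks-horizontally l b i i′ r v =
    shrinks-trans (shrinks-lefts l b i (r + i′) v) (shrinks-rights _ b i′ r v)

  subinterval-offset : ∀ {l r l′ r′} → l ℤ.≤ l′ → ℤ.+ r′ ℤ.+ l′ ℤ.≤ ℤ.+ r ℤ.+ l →
    ∃[ i ] ∃[ i′ ] l′ ≡ ℤ.+ i ℤ.+ l × i + (r′ + i′) ≡ r
  subinterval-offset {l} {r} {l′} {r′} l≤ ≤r =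
      ℤ.∣ l′ ℤ.- l ∣ , ℤ.∣ ℤ.+ r ℤ.+ l ℤ.- (ℤ.+ r′ ℤ.+ l′) ∣
    , trans (cancel l′ l) (cong (ℤ._+ l) (sym i≡))
    , ℤ.+-injective (trans (cong₂ (λ x y → x ℤ.+ (ℤ.+ r′ ℤ.+ y)) i≡ (ℤ.0≤i⇒+∣i∣≡i (ℤ.i≤j⇒0≤j-i ≤r)))
        (total l′ l (ℤ.+ r) (ℤ.+ r′)))
    where
    i≡ = ℤ.0≤i⇒+∣i∣≡i (ℤ.i≤j⇒0≤j-i l≤)
    cancel : ∀ x l → x ≡ x ℤ.- l ℤ.+ l
    cancel = ℤ.solve-∀
    total : ∀ x l r r′ → x ℤ.- l ℤ.+ (r′ ℤ.+ (r ℤ.+ l ℤ.- (r′ ℤ.+ x))) ≡ r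
    total = ℤ.solve-∀

  far-corner : Rect → Position
  far-corner R = shift (corner R) (at (width R) (height R))

  corner∈ : ∀ R → cells R (corner R)
  corner∈ R = subst (cells R) (⊕-stay (corner R)) (cell-inside R z≤n z≤n)

  far-corner∈ : ∀ R → cells R (far-corner R)
  far-corner∈ R = cell-inside R ≤-refl ≤-refl

  ⊑-corners : ∀ {Q R} → cells R (corner Q) → cells R (far-corner Q) → Q ⊑ R
  ⊑-corners ((l≤ , _) , (b≤ , _)) ((_ , ≤r) , (_ , ≤t)) ((≤x , x≤) , (≤y , y≤)) =
    (ℤ.≤-trans l≤ ≤x , ℤ.≤-trans x≤ ≤r) , (ℤ.≤-trans b≤ ≤y , ℤ.≤-trans y≤ ≤t)

  ⊑-shrinks : ∀ {Q R} → Q ⊑ R → Shrinks R Q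
  ⊑-shrinks {rect l′ b′ r′ v′} {rect l b r v} Q⊑R
    with (l≤ , _) , (b≤ , _) ← Q⊑R (corner∈ (rect l′ b′ r′ v′))
       | (_ , ≤r) , (_ , ≤t) ← Q⊑R (far-corner∈ (rect l′ b′ r′ v′))
    with i , i′ , refl , refl ← subinterval-offset {l} {r} {l′} {r′} l≤ ≤r
       | j , j′ , refl , refl ← subinterval-offset {b} {v} {b′} {v′} b≤ ≤t =
    shrinks-trans (shrinks-horizontally l b i i′ r′ (j + (v′ + j′)))
      (shrinks-sym diagonal (shrinks-horizontally b (ℤ.+ i ℤ.+ l) j j′ v′ r′))

  -- Merging two nearby rectangles

  shift-assoc : ∀ s t p → shift s (shift t p) ≡ shift (shift s t) p
  shift-assoc s t p = cong₂ _,_ (ℤ.+-assoc (proj₁ p) _ _) (ℤ.+-assoc (proj₂ p) _ _)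

  ++-congˡ : ∀ Z {X Y} → X ≈ Y → Z ++ X ≈ Z ++ Y
  ++-congˡ Z {X} {Y} X≈Y = ≈-trans (≈-↭ (++-comm Z X)) (≈-trans (≈-frame Z X≈Y) (≈-↭ (++-comm Y Z)))

  Absorbs : Rect → List Position → Position → Set
  Absorbs Q X p = ∃[ Q′ ] Q ⊑ Q′ × cells Q′ p × skeleton Q ++ X ↘ skeleton Q′

  forward-step : ∀ δ X p → (∀ {a Q} → cells Q a → Absorbs Q (map (shift a) X) (shift a p)) →
    ∀ {a Q} → cells Q a → Absorbs Q (map (shift a) (map (shift (vec δ)) (at 0 0 ∷ X)))
        (shift a (shift (vec δ) p))
  forward-step δ X p absorb {a} {Q} a∈Q
    with Q₁ , ⊑₁ , d∈Q₁ , red₁ ← extends δ a∈Q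
    with Q₂ , ⊑₂ , p∈Q₂ , red₂ ← absorb d∈Q₁
    = Q₂ , ⊑₂ ∘ ⊑₁ , subst (cells Q₂) (sym (shift-assoc a (vec δ) p)) p∈Q₂
    , subst (λ Z → skeleton Q ++ Z ↘ skeleton Q₂)
        (sym (trans (shift-shift a (vec δ) (at 0 0 ∷ X))
        (cong (_∷ map (shift (a ⊕ δ)) X) (⊕-stay (a ⊕ δ)))))
        (≈↘-trans (≈-reflexive (sym (++-assoc (skeleton Q) _ _))) (↘-trans (↘-frame _ red₁) red₂))

  -- Consecutive coins of a chain differ by an `Offset`, so each coin is near the rectangle that has
  -- absorbed its predecessor.
  forward : ∀ i j {a Q} → cells Q a → Absorbs Q (map (shift a) (links i j)) (shift a (at i j))
  forward 0 0 {a} {Q} a∈Q = Q , id , subst (cells Q) (sym (⊕-stay a)) a∈Q , to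
      (≈-reflexive (++-identityʳ _))
  forward 0 1 = forward-step N₁ [] (at 0 0) (forward 0 0)
  forward 1 0 = forward-step E₁ [] (at 0 0) (forward 0 0)
  forward 0 (suc (suc j)) {a} {Q} a∈Q =
      subst (λ p → Absorbs Q (map (shift a) (links 0 (2 + j))) (shift a p))
    (shift-at 0 2 0 j) (forward-step N₂ (links 0 j) (at 0 j) (forward 0 j) a∈Q)
  forward 1 (suc j) {a} {Q} a∈Q =
      subst (λ p → Absorbs Q (map (shift a) (links 1 (1 + j))) (shift a p))
    (shift-at 1 1 0 j) (forward-step NE (links 0 j) (at 0 j) (forward 0 j) a∈Q)
  forward (suc (suc i)) j {a} {Q} a∈Q =
      subst (λ p → Absorbs Q (map (shift a) (links (2 + i) j)) (shift a p))
    (shift-at 2 0 i j) (forward-step E₂ (links i j) (at i j) (forward i j) a∈Q)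

  Absorbs₂ : Rect → List Position → Position → Position → Set
  Absorbs₂ Q X a p = ∃[ Q′ ] Q ⊑ Q′ × cells Q′ a × cells Q′ p × skeleton Q ++ X ↘ skeleton Q′

  backward-step : ∀ δ X p → (∀ {a Q} → Extends Q (shift a p) →
      Absorbs₂ Q (map (shift a) X) a (shift a p)) →
    ∀ {a Q} → Extends Q (shift a (shift (vec δ) p)) →
        Absorbs₂ Q (map (shift a) (vec δ ▹ X)) a (shift a (shift (vec δ) p))
  backward-step δ X p absorb {a} {Q} ext
    with Q₁ , ⊑₁ , d∈Q₁ , p∈Q₁ , red₁ ← absorb (subst (Extends Q) (shift-assoc a (vec δ) p) ext)
    with Q₂ , ⊑₂ , a∈Q₂ , red₂ ← extends (opposite δ) d∈Q₁
    = Q₂ , ⊑₂ ∘ ⊑₁ , subst (cells Q₂) (⊕-staypposite a δ) a∈Q₂ , ⊑₂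
        (subst (cells Q₁) (sym (shift-assoc a (vec δ) p)) p∈Q₁)
    , subst (λ Z → skeleton Q ++ Z ↘ skeleton Q₂)
        (sym (cong₂ _∷_ (trans (⊕-stay a) (sym (⊕-staypposite a δ))) (shift-shift a (vec δ) X)))
        (≈↘-trans (≈-trans (++-congˡ (skeleton Q) (≈-↭ (∷↭∷ʳ _ _)))
            (≈-reflexive (sym (++-assoc (skeleton Q) _ _))))
          (↘-trans (↘-frame _ red₁) red₂))

  backward-base : ∀ {a Q} → Extends Q (shift a (at 0 0)) →
      Absorbs₂ Q (map (shift a) [ at 0 0 ]) a (shift a (at 0 0))
  backward-base {a} (Q′ , ⊑Q′ , a∈Q′ , red) =
      Q′ , ⊑Q′ , subst (cells Q′) (⊕-stay a) a∈Q′ , a∈Q′ , red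

  -- The chain is absorbed from its last coin down to its first. The hypothesis is about extending Q
  -- because the last coin itself need not lie in Q.
  backward : ∀ i j {a Q} → Extends Q (shift a (at i j)) →
      Absorbs₂ Q (map (shift a) (chain i j)) a (shift a (at i j))
  backward 0 0 = backward-base
  backward 0 1 = backward-step N₁ [ at 0 0 ] (at 0 0) backward-base
  backward 1 0 = backward-step E₁ [ at 0 0 ] (at 0 0) backward-base
  backward 0 (suc (suc j)) {a} {Q} =
      subst (λ p → Extends Q (shift a p) →
      Absorbs₂ Q (map (shift a) (chain 0 (2 + j))) a (shift a p))
    (shift-at 0 2 0 j) (backward-step N₂ (chain 0 j) (at 0 j) (backward 0 j))
  backward 1 (suc j) {a} {Q} = subst
      (λ p → Extends Q (shift a p) → Absorbs₂ Q (map (shift a) (chain 1 (1 + j))) a (shift a p))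
    (shift-at 1 1 0 j) (backward-step NE (chain 0 j) (at 0 j) (backward 0 j))
  backward (suc (suc i)) j {a} {Q} =
      subst (λ p → Extends Q (shift a p) →
      Absorbs₂ Q (map (shift a) (chain (2 + i) j)) a (shift a p))
    (shift-at 2 0 i j) (backward-step E₂ (chain i j) (at i j) (backward i j))

  Merge : Rect → Rect → Set
  Merge Q R = ∃[ Q′ ] Q ⊑ Q′ × R ⊑ Q′ × skeleton Q ++ skeleton R ↘ skeleton Q′

  merge-comm : ∀ {Q R} → Merge Q R → Merge R Q
  merge-comm {Q} {R} (Q′ , Q⊑ , R⊑ , red) =
    Q′ , R⊑ , Q⊑ , ≈↘-trans (≈-↭ (++-comm (skeleton R) (skeleton Q))) red

  -- Cells on some minimal chain of R: a rectangle that can take in a coin at p then swallows the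
  -- rest of that chain coin by coin, in both directions from p.
  record Absorbable (R : Rect) (p : Position) : Set where
    constructor absorbing
    field
      cell  : cells R p
      merge : ∀ {Q} → Extends Q p → Merge Q R

  -- The chain is routed through p and cut there; `backward` absorbs the part from p to the lower
  -- left corner and `forward` the part from p to the upper right one.
  absorbable-even : ∀ l b i i′ j j′ → Even (i + j) ⊎ Even (i′ + j′) →
    Absorbable (rect l b (i + i′) (j + j′)) (shift (l , b) (at i j))
  absorbable-even l b i i′ j j′ ev =
      absorbing (cell-inside R (ℕ.m≤m+n i i′) (ℕ.m≤m+n j j′)) λ {Q} ext → lemma ext
    where
    R = rect l b (i + i′) (j + j′)
    a = l , b
    p = shift a (at i j)
    decompose : skeleton R ≈ map (shift a) (chain i j) ++ map (shift p) (links i′ j′)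
    decompose = ≈-trans (≈-map (shift-isometry a) (split i i′ j j′ ev))
      (≈-reflexive (trans (map-++ (shift a) (chain i j) _)
          (cong (map (shift a) (chain i j) ++_) (shift-shift a (at i j) (links i′ j′)))))
    lemma : ∀ {Q} → Extends Q p → Merge Q R
    lemma {Q} ext
      with Q₁ , ⊑₁ , a∈Q₁ , p∈Q₁ , red₁ ← backward i j ext
      with Q₂ , ⊑₂ , t∈Q₂ , red₂ ← forward i′ j′ p∈Q₁
      = Q₂ , ⊑₂ ∘ ⊑₁
      -- A rectangle that contains two opposite corners of R contains R.
      , ⊑-corners {R} {Q₂} (⊑₂ a∈Q₁) (subst (cells Q₂)
          (trans (shift-at-⊕ a i j i′ j′)
          (cong₂ (λ x y → shift a (at x y)) (ℕ.+-comm i′ i) (ℕ.+-comm j′ j))) t∈Q₂)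
      , ≈↘-trans (≈-trans (++-congˡ (skeleton Q) decompose)
          (≈-reflexive (sym (++-assoc (skeleton Q) _ _))))
          (↘-trans (↘-frame _ red₁) red₂)

  module _ (τ : Symmetry) where
    open Symmetry τ

    merge-sym : ∀ {Q R} → Merge (σᴿ Q) (σᴿ R) → Merge Q R
    merge-sym {Q} {R} (Q′ , Q⊑ , R⊑ , red) =
        σᴿ Q′ , (λ c → cells-σ⁻ τ (Q⊑ (σ-cells c))) , (λ c → cells-σ⁻ τ (R⊑ (σ-cells c)))
      , ≈↘-trans (≈-trans (map-σ-++ τ Q (skeleton R))
          (≈-map isometry (++-congˡ (skeleton (σᴿ Q)) (σ-skeleton R))))
          (↘≈-trans (↘-map isometry red) (σ-skeleton Q′))

    absorbable-sym : ∀ {R p} → cells R p → Absorbable (σᴿ R) (σ p) → Absorbable R p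
    absorbable-sym c (absorbing _ mrg) = absorbing c λ {Q} ext →
      merge-sym (mrg (extends-sym τ (subst₂ Extends (sym (involutiveᴿ Q)) (sym (involutive _))
          ext)))

  even+even : ∀ i {j} → Even i → Even j → Even (i + j)
  even+even 0 _ ev              = ev
  even+even (suc (suc i)) ev ev′ = even+even i ev ev′

  odd+odd : ∀ i {j} → Even (suc i) → Even (suc j) → Even (i + j)
  odd+odd 1 _ od              = od
  odd+odd (suc (suc i)) od od′ = odd+odd i od od′

  -- This uses the chain between the lower right and the upper left corner; i′ + j is the distance
  -- of p from the lower right one.
  absorbable-mirror : ∀ l b i i′ j j′ → Even (i′ + j) →
    Absorbable (rect l b (i + i′) (j + j′)) (shift (l , b) (at i j))
  absorbable-mirror l b i i′ j j′ ev = absorbable-sym mirror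
    (cell-inside (rect l b (i + i′) (j + j′)) (ℕ.m≤m+n i i′) (ℕ.m≤m+n j j′))
    (subst₂ Absorbable (cong (λ r → rect (ℤ.- (ℤ.+ (i + i′) ℤ.+ l)) b r (j + j′)) (ℕ.+-comm i′ i))
      (cong (_, ℤ.+ j ℤ.+ b) (turn (ℤ.+ i) (ℤ.+ i′) l))
      (absorbable-even (ℤ.- (ℤ.+ (i + i′) ℤ.+ l)) b i′ i j j′ (inj₁ ev)))
    where
    turn : ∀ i i′ l → i′ ℤ.+ (ℤ.- (i ℤ.+ i′ ℤ.+ l)) ≡ ℤ.0ℤ ℤ.- (i ℤ.+ l)
    turn = ℤ.solve-∀

  -- The skeleton can be routed through every cell, except for the cells at odd distance from the
  -- corners when both sides have an odd number of cells; such a cell is strictly inside one of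
  -- the two intervals that define the rectangle, and its two neighbors there are not exceptional.
  data Class (R : Rect) (p : Position) : Set where
    absorbable : Absorbable R p → Class R p
    horizontal : Absorbable R (p ⊕ E₁) → Absorbable R (p ⊕ W₁) → Class R p
    vertical   : Absorbable R (p ⊕ N₁) → Absorbable R (p ⊕ S₁) → Class R p

  classify : ∀ {R p} → cells R p → Class R p
  classify p∈R with cell-offsets p∈R
  ... | offsets l b i i′ j j′ with parity i | parity i′ | parity j | parity j′
  ... | inj₁ ei | _       | inj₁ ej | _       =
      absorbable (absorbable-even l b i i′ j j′ (inj₁ (even+even i ei ej)))
  ... | inj₂ oi | _       | inj₂ oj | _       =
      absorbable (absorbable-even l b i i′ j j′ (inj₁ (odd+odd i oi oj)))
  ... | _       | inj₁ ei | _       | inj₁ ej =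
      absorbable (absorbable-even l b i i′ j j′ (inj₂ (even+even i′ ei ej)))
  ... | _       | inj₂ oi | _       | inj₂ oj =
      absorbable (absorbable-even l b i i′ j j′ (inj₂ (odd+odd i′ oi oj)))
  ... | _       | inj₁ ei | inj₁ ej | _       =
      absorbable (absorbable-mirror l b i i′ j j′ (even+even i′ ei ej))
  ... | _       | inj₂ oi | inj₂ oj | _       =
      absorbable (absorbable-mirror l b i i′ j j′ (odd+odd i′ oi oj))
  classify _ | offsets l b (suc i) (suc i′) j j′ | inj₂ oi | inj₂ oi′ | inj₁ ej | inj₁ ej′ =
      horizontal
    (subst₂ Absorbable (cong (λ r → rect l b r (j + j′)) (cong suc (sym (ℕ.+-suc i i′))))
        (sym (shift-at-⊕ (l , b) (suc i) j 1 0))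
      (absorbable-even l b (2 + i) i′ j j′ (inj₁ (even+even i oi ej))))
    (subst₂ Absorbable (cong (λ r → rect l b r (j + j′)) (ℕ.+-suc i (suc i′)))
      (cong₂ _,_ (ℤ.+-assoc ℤ.-1ℤ (ℤ.+ suc i) l) (sym (ℤ.+-identityˡ _)))
      (absorbable-even l b i (2 + i′) j j′ (inj₁ (even+even i oi ej))))
  classify _ | offsets l b i i′ (suc j) (suc j′) | inj₁ ei | inj₁ ei′ | inj₂ oj | inj₂ oj′ =
      vertical
    (subst₂ Absorbable (cong (rect l b (i + i′)) (cong suc (sym (ℕ.+-suc j j′))))
        (sym (shift-at-⊕ (l , b) i (suc j) 0 1))
      (absorbable-even l b i i′ (2 + j) j′ (inj₁ (even+even i ei oj))))
    (subst₂ Absorbable (cong (rect l b (i + i′)) (ℕ.+-suc j (suc j′)))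
      (cong₂ _,_ (sym (ℤ.+-identityˡ _)) (ℤ.+-assoc ℤ.-1ℤ (ℤ.+ suc j) b))
      (absorbable-even l b i i′ j (2 + j′) (inj₁ (even+even i ei oj))))

  -- An offset begins with a horizontal unit step towards a nearby cell, unless it is vertical of length 2.
  data Sideways (δ : Offset) : Set where
    east  : ∀ β → shift (vec E₁) (vec β) ≡ vec δ → Sideways δ
    west  : ∀ β → shift (vec W₁) (vec β) ≡ vec δ → Sideways δ
    north : δ ≡ N₂ → Sideways δ
    south : δ ≡ S₂ → Sideways δ

  sideways : ∀ δ → Sideways δ
  sideways stay  = east W₁ refl
  sideways N₁  = east NW refl
  sideways E₁  = east stay refl
  sideways S₁  = east SW refl
  sideways W₁  = west stay refl
  sideways N₂ = north refl
  sideways E₂ = east E₁ refl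
  sideways S₂ = south refl
  sideways W₂ = west W₁ refl
  sideways NE = east N₁ refl
  sideways NW = west N₁ refl
  sideways SE = east S₁ refl
  sideways SW = west S₁ refl

  data Upright (δ : Offset) : Set where
    north : ∀ β → shift (vec N₁) (vec β) ≡ vec δ → Upright δ
    south : ∀ β → shift (vec S₁) (vec β) ≡ vec δ → Upright δ
    east  : δ ≡ E₂ → Upright δ
    west  : δ ≡ W₂ → Upright δ

  upright : ∀ δ → Upright δ
  upright stay  = north S₁ refl
  upright N₁  = north stay refl
  upright E₁  = north SE refl
  upright S₁  = south stay refl
  upright W₁  = north SW refl
  upright N₂ = north N₁ refl
  upright E₂ = east refl
  upright S₂ = south S₁ refl
  upright W₂ = west refl
  upright NE = north E₁ refl
  upright NW = north W₁ refl
  upright SE = south E₁ refl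
  upright SW = south W₁ refl

  ⊕-comm : ∀ p α β → (p ⊕ α) ⊕ β ≡ (p ⊕ β) ⊕ α
  ⊕-comm (x , y) α β = cong₂ _,_ (swap₃ (proj₁ (vec α)) (proj₁ (vec β)) x)
      (swap₃ (proj₂ (vec α)) (proj₂ (vec β)) y)
    where
    swap₃ : ∀ a b x → b ℤ.+ (a ℤ.+ x) ≡ a ℤ.+ (b ℤ.+ x)
    swap₃ = ℤ.solve-∀

  merge-via : ∀ {Q R p q} β → Absorbable R p → cells Q q → q ≡ p ⊕ β → Merge Q R
  merge-via {Q} {R} {p} β abs q∈Q refl = Absorbable.merge abs
    (subst (Extends Q) (⊕-staypposite p β) (extends (opposite β) q∈Q))

  merge-via′ : ∀ {Q R p q} β → Absorbable Q q → cells R p → q ≡ p ⊕ β → Merge Q R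
  merge-via′ {Q} {R} β abs p∈R refl = merge-comm (Absorbable.merge abs (extends β p∈R))

  -- If p is exceptional, one of its two absorbable neighbors takes its place, provided it is still
  -- near q = p ⊕ δ. This fails only if δ has length 2 and is perpendicular to the line of these
  -- neighbors; then the class of q in Q decides.
  merge-near : ∀ {Q R p} δ → cells R p → cells Q (p ⊕ δ) → Merge Q R
  merge-near {p = p} δ p∈R q∈Q with classify p∈R
  merge-near {p = p} δ p∈R q∈Q | absorbable abs = merge-via δ abs q∈Q refl
  merge-near {p = p} δ p∈R q∈Q | horizontal abse absw with sideways δ
  ... | east β eq = merge-via β abse q∈Q (sym (⊕-⊕ p E₁ β δ eq))
  ... | west β eq = merge-via β absw q∈Q (sym (⊕-⊕ p W₁ β δ eq))
  ... | north refl with classify q∈Q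
  ...   | absorbable abs    = merge-via′ N₂ abs p∈R refl
  -- Both cells are exceptional in the same direction, so both are replaced by their eastern
  -- neighbors, which differ by the same offset.
  ...   | horizontal abs _  = merge-via′ N₂ abs (Absorbable.cell abse) (⊕-comm p N₂ E₁)
  -- The southern neighbor of q is absorbable in Q and is adjacent to p.
  ...   | vertical _ abs    = merge-via′ N₁ abs p∈R (⊕-⊕ p N₂ S₁ N₁ refl)
  merge-near {p = p} δ p∈R q∈Q | horizontal abse absw | south refl with classify q∈Q
  ...   | absorbable abs    = merge-via′ S₂ abs p∈R refl
  ...   | horizontal abs _  = merge-via′ S₂ abs (Absorbable.cell abse) (⊕-comm p S₂ E₁)
  ...   | vertical abs _    = merge-via′ S₁ abs p∈R (⊕-⊕ p S₂ N₁ S₁ refl)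
  merge-near {p = p} δ p∈R q∈Q | vertical absn abss with upright δ
  ... | north β eq = merge-via β absn q∈Q (sym (⊕-⊕ p N₁ β δ eq))
  ... | south β eq = merge-via β abss q∈Q (sym (⊕-⊕ p S₁ β δ eq))
  ... | east refl with classify q∈Q
  ...   | absorbable abs    = merge-via′ E₂ abs p∈R refl
  ...   | vertical abs _    = merge-via′ E₂ abs (Absorbable.cell absn) (⊕-comm p E₂ N₁)
  ...   | horizontal _ abs  = merge-via′ E₁ abs p∈R (⊕-⊕ p E₂ W₁ E₁ refl)
  merge-near {p = p} δ p∈R q∈Q | vertical absn abss | west refl with classify q∈Q
  ...   | absorbable abs    = merge-via′ W₂ abs p∈R refl
  ...   | vertical abs _    = merge-via′ W₂ abs (Absorbable.cell absn) (⊕-comm p W₂ N₁)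
  ...   | horizontal abs _  = merge-via′ W₁ abs p∈R (⊕-⊕ p W₂ E₁ W₁ refl)

  -- Separated families of rectangles

  Near : Rect → Rect → Set
  Near R Q = ∃[ p ] ∃[ δ ] cells R p × cells Q (p ⊕ δ)

  near-sym : ∀ {Q R} → Near Q R → Near R Q
  near-sym {Q} (p , δ , p∈Q , q∈R) =
      p ⊕ δ , opposite δ , q∈R , subst (cells Q) (sym (⊕-staypposite p δ)) p∈Q

  allOffsets : List Offset
  allOffsets = stay ∷ N₁ ∷ E₁ ∷ S₁ ∷ W₁ ∷ N₂ ∷ E₂ ∷ S₂ ∷ W₂ ∷ NE ∷ NW ∷ SE ∷ SW ∷ []

  ∈-allOffsets : ∀ δ → δ ∈ allOffsets
  ∈-allOffsets stay = here refl
  ∈-allOffsets N₁   = there (here refl)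
  ∈-allOffsets E₁   = there (there (here refl))
  ∈-allOffsets S₁   = there (there (there (here refl)))
  ∈-allOffsets W₁   = there (there (there (there (here refl))))
  ∈-allOffsets N₂   = there (there (there (there (there (here refl)))))
  ∈-allOffsets E₂   = there (there (there (there (there (there (here refl))))))
  ∈-allOffsets S₂   = there (there (there (there (there (there (there (here refl)))))))
  ∈-allOffsets W₂   = there (there (there (there (there (there (there (there (here refl))))))))
  ∈-allOffsets NE   = there (there (there
      (there (there (there (there (there (there (here refl)))))))))
  ∈-allOffsets NW   = there (there (there
      (there (there (there (there (there (there (there (here refl))))))))))
  ∈-allOffsets SE   = there (there (there
      (there (there (there (there (there (there (there (there (here refl)))))))))))
  ∈-allOffsets SW   = there (there (there
      (there (there (there (there (there (there (there (there (there (here refl))))))))))))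

  cells? : ∀ R p → Dec (cells R p)
  cells? (rect l b w h) (x , y) =
    ((l ℤ.≤? x) ×-dec (x ℤ.≤? ℤ.+ w ℤ.+ l)) ×-dec ((b ℤ.≤? y) ×-dec (y ℤ.≤? ℤ.+ h ℤ.+ b))

  near? : ∀ R Q → Dec (Near R Q)
  near? R Q = map′ found search
    (Fin.any? λ i → Fin.any? λ j → any? (λ δ → cells? Q (cell i j ⊕ δ)) allOffsets)
    where
    cell : Fin (suc (width R)) → Fin (suc (height R)) → Position
    cell i j = shift (corner R) (at (toℕ i) (toℕ j))
    found : (∃[ i ] ∃[ j ] Any (λ δ → cells Q (cell i j ⊕ δ)) allOffsets) → Near R Q
    found (i , j , near) with δ , _ , q∈Q ← find near =
      cell i j , δ , cell-inside R (ℕ.s≤s⁻¹ (toℕ<n i)) (ℕ.s≤s⁻¹ (toℕ<n j)) , q∈Q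
    search : Near R Q → ∃[ i ] ∃[ j ] Any (λ δ → cells Q (cell i j ⊕ δ)) allOffsets
    search (p , δ , p∈R , q∈Q) with offsets l b i i′ j j′ ← cell-offsets p∈R =
      fromℕ< i< , fromℕ< j< , lose (∈-allOffsets δ)
        (subst₂ (λ i j → cells Q (shift (l , b) (at i j) ⊕ δ)) (sym (toℕ-fromℕ< i<))
            (sym (toℕ-fromℕ< j<)) q∈Q)
      where
      i< = s≤s (ℕ.m≤m+n i i′)
      j< = s≤s (ℕ.m≤m+n j j′)

  Separated : List Rect → Set
  Separated = AllPairs (λ Q R → ¬ Near Q R)

  skeletons : List Rect → List Position
  skeletons = concatMap skeleton

  Covered : List Rect → PositionSet
  Covered L p = Any (λ R → cells R p) L

  extract : ∀ {P : Rect → Set} {L} → Separated L → Any P L →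
    ∃[ R ] ∃[ L′ ] P R × L ↭ R ∷ L′ × Separated L′
  extract (_ ∷ sep) (here PR) = _ , _ , PR , ↭-refl , sep
  extract {L = Q ∷ L} (far ∷ sep) (there any) with R , L′ , PR , L↭ , sep′ ← extract sep any =
    R , Q ∷ L′ , PR , ↭-trans (prep Q L↭) (Perm.swap Q R ↭-refl) , All.tail (All-resp-↭ L↭ far) ∷
        sep′

  skeletons-↭ : ∀ {L L′} → L ↭ L′ → skeletons L ↭ skeletons L′
  skeletons-↭ Perm.refl = ↭-refl
  skeletons-↭ (Perm.prep R L↭) = ++⁺ˡ (skeleton R) (skeletons-↭ L↭)
  skeletons-↭ (Perm.swap Q R L↭) =
    ↭-trans (shifts (skeleton Q) (skeleton R))
        (++⁺ˡ (skeleton R) (++⁺ˡ (skeleton Q) (skeletons-↭ L↭)))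
  skeletons-↭ (Perm.trans L↭ L↭′) = ↭-trans (skeletons-↭ L↭) (skeletons-↭ L↭′)

  Covers : List Rect → List Rect → Set
  Covers L′ L = ∀ {p} → Covered L p → Covered L′ p

  -- A merged rectangle may be near rectangles that R was not near, so it is inserted anew. Each
  -- merge uses up a member of L, hence the bound k for the recursion.
  insert : ∀ k R L → length L ≤ k → Separated L →
    ∃[ L′ ] Separated L′ × Covers L′ (R ∷ L) × skeletons (R ∷ L) ↘ skeletons L′
  insert k R L _ sep with any? (near? R) L
  ... | no far = R ∷ L , ¬Any⇒All¬ L far ∷ sep , id , ↘-refl
  insert zero R [] _ sep | yes ()
  insert (suc k) R L ≤k sep | yes near
    with Q , L₁ , (p , δ , p∈R , q∈Q) , L↭ , sep₁ ← extract sep near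
    with R′ , Q⊑ , R⊑ , red ← merge-near δ p∈R q∈Q
    with L′ , sep′ , covers , red′ ←
        insert k R′ L₁ (ℕ.s≤s⁻¹ (≤-trans (≤-reflexive (sym (↭-length L↭))) ≤k)) sep₁
    = L′ , sep′ , covers ∘ covers₁
    , ≈↘-trans (≈-↭ (++⁺ˡ (skeleton R) (skeletons-↭ L↭)))
        (≈↘-trans (≈-trans (≈-reflexive (sym (++-assoc (skeleton R) _ _)))
            (≈-frame _ (≈-↭ (++-comm (skeleton R) (skeleton Q)))))
          (↘-trans (↘-frame (skeletons L₁) red) red′))
    where
    covers₁ : Covers (R′ ∷ L₁) (R ∷ L)
    covers₁ (here p∈R) = here (R⊑ p∈R)
    covers₁ (there p∈L) with Any-resp-↭ L↭ p∈L
    ... | here p∈Q   = here (Q⊑ p∈Q)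
    ... | there p∈L₁ = there p∈L₁

  cellᴿ : Position → Rect
  cellᴿ (x , y) = rect x y 0 0

  normalise : ∀ X → ∃[ L ] Separated L × (∀ {p} → p ∈ X → Covered L p) × X ↘ skeletons L
  normalise [] = [] , [] , (λ ()) , ↘-refl
  normalise (p ∷ X)
    with L , sep , covers , red ← normalise X
    with L′ , sep′ , covers′ , red′ ← insert (length L) (cellᴿ p) L ≤-refl sep
    = L′ , sep′
    , (λ { (here refl) → covers′ (here (corner∈ (cellᴿ p))) ; (there q∈X) →
        covers′ (there (covers q∈X)) })
    , ↘-trans (≈↘-trans (≈-↭ (∷↭∷ʳ p X)) (↘≈-trans (↘-frame [ p ] red)
        (≈-trans (≈-↭ (↭-sym (∷↭∷ʳ p _))) (≈-reflexive (cong (_∷ skeletons L) (sym (⊕-stay p)))))))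
            red′

  separated-unique : ∀ {L Q R p} δ → Separated L → Q ∈ L → R ∈ L → cells Q p → cells R (p ⊕ δ) →
      Q ≡ R
  separated-unique δ (_ ∷ _) (here refl) (here refl) _ _ = refl
  separated-unique δ (far ∷ _) (here refl) (there R∈L) p∈Q q∈R =
      ⊥-elim (All.lookup far R∈L (_ , δ , p∈Q , q∈R))
  separated-unique δ (far ∷ _) (there Q∈L) (here refl) p∈Q q∈R =
      ⊥-elim (All.lookup far Q∈L (near-sym (_ , δ , p∈Q , q∈R)))
  separated-unique δ (_ ∷ sep) (there Q∈L) (there R∈L) p∈Q q∈R =
      separated-unique δ sep Q∈L R∈L p∈Q q∈R

  data Cardinal : Offset → Set where
    isN : Cardinal N₁
    isE : Cardinal E₁
    isS : Cardinal S₁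
    isW : Cardinal W₁

  neighbor-cardinal : ∀ {p q} → q ∈ neighbors p → ∃[ α ] Cardinal α × q ≡ p ⊕ α
  neighbor-cardinal {x , y} (here refl) = W₁ , isW , cong (_ ,_) (sym (ℤ.+-identityˡ y))
  neighbor-cardinal {x , y} (there (here refl)) = E₁ , isE , cong (_ ,_) (sym (ℤ.+-identityˡ y))
  neighbor-cardinal {x , y} (there (there (here refl))) =
      N₁ , isN , cong (_, _) (sym (ℤ.+-identityˡ x))
  neighbor-cardinal {x , y} (there (there (there (here refl)))) =
      S₁ , isS , cong (_, _) (sym (ℤ.+-identityˡ x))

  cardinal-difference : ∀ {α β} → Cardinal α → Cardinal β → ∃[ δ ] shift (vec α) (vec δ) ≡ vec β
  cardinal-difference isN isN = stay , refl
  cardinal-difference isN isE = SE , refl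
  cardinal-difference isN isS = S₂ , refl
  cardinal-difference isN isW = SW , refl
  cardinal-difference isE isN = NW , refl
  cardinal-difference isE isE = stay , refl
  cardinal-difference isE isS = SW , refl
  cardinal-difference isE isW = W₂ , refl
  cardinal-difference isS isN = N₂ , refl
  cardinal-difference isS isE = NE , refl
  cardinal-difference isS isS = stay , refl
  cardinal-difference isS isW = NW , refl
  cardinal-difference isW isN = NE , refl
  cardinal-difference isW isE = E₂ , refl
  cardinal-difference isW isS = SE , refl
  cardinal-difference isW isW = stay , refl

  neighbors-near : ∀ {p q r} → q ∈ neighbors p → r ∈ neighbors p → ∃[ δ ] r ≡ q ⊕ δ
  neighbors-near {p} nq nr
    with α , cα , refl ← neighbor-cardinal nq
       | β , cβ , refl ← neighbor-cardinal nr
    with δ , eq ← cardinal-difference cα cβ = δ , sym (⊕-⊕ p α δ β eq)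

  between : ∀ {l x m} → (l ℤ.≤ ℤ.pred x × ℤ.pred x ℤ.≤ m) → (l ℤ.≤ ℤ.suc x × ℤ.suc x ℤ.≤ m) →
      l ℤ.≤ x × x ℤ.≤ m
  between {x = x} (l≤ , _) (_ , ≤m) =
      ℤ.≤-trans l≤ (ℤ.i≤j⇒pred[i]≤j {x} ℤ.≤-refl) , ℤ.≤-trans (ℤ.i≤suc[i] x) ≤m

  pattern to-west  = here refl
  pattern to-east  = there (here refl)
  pattern to-north = there (there (here refl))
  pattern to-south = there (there (there (here refl)))

  cells-convex : ∀ R {p q r} → q ≢ r → q ∈ neighbors p → r ∈ neighbors p → cells R q → cells R r →
      cells R p
  cells-convex R q≢r to-west  to-west  _ _ = ⊥-elim (q≢r refl)
  cells-convex R q≢r to-west  to-east  (qx , qy) (rx , ry) = between qx rx , qy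
  cells-convex R q≢r to-west  to-north (qx , qy) (rx , ry) = rx , qy
  cells-convex R q≢r to-west  to-south (qx , qy) (rx , ry) = rx , qy
  cells-convex R q≢r to-east  to-west  (qx , qy) (rx , ry) = between rx qx , qy
  cells-convex R q≢r to-east  to-east  _ _ = ⊥-elim (q≢r refl)
  cells-convex R q≢r to-east  to-north (qx , qy) (rx , ry) = rx , qy
  cells-convex R q≢r to-east  to-south (qx , qy) (rx , ry) = rx , qy
  cells-convex R q≢r to-north to-west  (qx , qy) (rx , ry) = qx , ry
  cells-convex R q≢r to-north to-east  (qx , qy) (rx , ry) = qx , ry
  cells-convex R q≢r to-north to-north _ _ = ⊥-elim (q≢r refl)
  cells-convex R q≢r to-north to-south (qx , qy) (rx , ry) = qx , between ry qy
  cells-convex R q≢r to-south to-west  (qx , qy) (rx , ry) = qx , ry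
  cells-convex R q≢r to-south to-east  (qx , qy) (rx , ry) = qx , ry
  cells-convex R q≢r to-south to-north (qx , qy) (rx , ry) = qx , between qy ry
  cells-convex R q≢r to-south to-south _ _ = ⊥-elim (q≢r refl)

  cells-closed : ∀ R → Closed (cells R)
  cells-closed R (q , r , q≢r , nq , nr , q∈R , r∈R) = cells-convex R q≢r nq nr q∈R r∈R

  -- Two neighbors of one position are near each other, so in a separated family they belong to the
  -- same rectangle, which is closed.
  covered-closed : ∀ {L} → Separated L → Closed (Covered L)
  covered-closed sep (q , r , q≢r , nq , nr , q∈L , r∈L)
    with Q , Q∈L , q∈Q ← find q∈L
       | R , R∈L , r∈R ← find r∈L
    with δ , refl ← neighbors-near nq nr
    with refl ← separated-unique δ sep Q∈L R∈L q∈Q r∈R = lose Q∈L (cells-convex Q q≢r nq nr q∈Q r∈R)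

  -- By `exposing`, every cell can be made to appear from the chain, and transformations never leave
  -- a closed set.
  skeleton-spans : ∀ R {C : PositionSet} → Closed C → (∀ {p} → p ∈ skeleton R → C p) → ∀ {p} →
      cells R p → C p
  skeleton-spans R closed skeleton⊆C p∈R
    with offsets l b i i′ j j′ ← cell-offsets p∈R
    with Y , ≈Y , exposed ← exposing i i′ j j′ =
    ⇒-closed closed
      (map-⇒ (shift-isometry (l , b))
          (forth (to ≈Y) ◅◅ expose (s≤s (≤-trans (≤-reflexive (sym (≈-length ≈Y))) (ℕ.n≤1+n _)))
          exposed))
      skeleton⊆C (here refl)

  InChainBox : ℕ → ℕ → Position → Set
  InChainBox r v p = ∃[ i ] ∃[ j ] p ≡ at i j × i ≤ r × j ≤ v

  step-box : ∀ a b {r v X p} → (∀ {q} → q ∈ X → InChainBox r v q) → p ∈ at a b ▹ X →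
      InChainBox (a + r) (b + v) p
  step-box a b X⊆ (here refl) = 0 , 0 , refl , z≤n , z≤n
  step-box a b X⊆ (there p∈) with q , q∈X , refl ← ∈-map⁻ _ p∈ with i , j , refl , i≤ , j≤ ←
      X⊆ q∈X =
    a + i , b + j , shift-at a b i j , ℕ.+-monoʳ-≤ a i≤ , ℕ.+-monoʳ-≤ b j≤

  chain-box : ∀ r v {p} → p ∈ chain r v → InChainBox r v p
  chain-box 0 0 (here refl)   = 0 , 0 , refl , z≤n , z≤n
  chain-box 0 1               = step-box 0 1 {0} {0} (chain-box 0 0)
  chain-box 0 (suc (suc v))   = step-box 0 2 (chain-box 0 v)
  chain-box 1 0               = step-box 1 0 {0} {0} (chain-box 0 0)
  chain-box 1 (suc v)         = step-box 1 1 (chain-box 0 v)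
  chain-box (suc (suc r)) v   = step-box 2 0 (chain-box r v)

  skeleton⊆cells : ∀ R {p} → p ∈ skeleton R → cells R p
  skeleton⊆cells R p∈ with q , q∈ , refl ← ∈-map⁻ _ p∈ with i , j , refl , i≤ , j≤ ←
      chain-box (width R) (height R) q∈ =
    cell-inside R i≤ j≤

  -- Sets of coins with the same closure

  -- Inclusion of closures, stated by quantifying over all closed sets; this avoids the growth
  -- sequence and composes directly with `⇒-closed`.
  Spans : List Position → List Position → Set₁
  Spans X Y = ∀ {C : PositionSet} → Closed C → (∀ {p} → p ∈ X → C p) → ∀ {p} → p ∈ Y → C p

  skeletons∈ : ∀ {L R p} → R ∈ L → p ∈ skeleton R → p ∈ skeletons L
  skeletons∈ R∈L p∈R = ∈-concatMap⁺ skeleton (lose R∈L p∈R)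

  covered-spanned : ∀ {X L} {C : PositionSet} → X ↘ skeletons L → Closed C → (∀ {p} → p ∈ X → C p) →
    ∀ {p} → Covered L p → C p
  covered-spanned red closed X⊆C p∈L with R , R∈L , p∈R ← find p∈L =
    skeleton-spans R closed (λ q∈ → ⇒-closed closed (forth red) X⊆C (skeletons∈ R∈L q∈)) p∈R

  -- R is connected by unit steps, and a unit step cannot pass from one member of a separated family
  -- to another.
  contained : ∀ {L} R → Separated L → (∀ {p} → cells R p → Covered L p) → ∃[ Q ] Q ∈ L × R ⊑ Q
  contained {L} R sep R⊆L with Q , Q∈L , c∈Q ← find (R⊆L (corner∈ R)) =
    Q , Q∈L , λ p∈R → lemma p∈R (cell-offsets p∈R)
    where
    step : ∀ {p} δ → cells Q p → cells R (p ⊕ δ) → cells Q (p ⊕ δ)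
    step δ p∈Q q∈R with Q′ , Q′∈L , q∈Q′ ← find (R⊆L q∈R)
      with refl ← separated-unique δ sep Q∈L Q′∈L p∈Q q∈Q′ = q∈Q′
    cell : ∀ i j → i ≤ width R → j ≤ height R → cells Q (shift (corner R) (at i j))
    cell 0 0 _ _ = subst (cells Q) (sym (⊕-stay (corner R))) c∈Q
    cell (suc i) 0 i≤ j≤ = subst (cells Q) (shift-at-⊕ (corner R) i 0 1 0)
      (step E₁ (cell i 0 (ℕ.<⇒≤ i≤) j≤)
          (subst (cells R) (sym (shift-at-⊕ (corner R) i 0 1 0)) (cell-inside R i≤ j≤)))
    cell i (suc j) i≤ j≤ = subst (cells Q) (shift-at-⊕ (corner R) i j 0 1)
      (step N₁ (cell i j i≤ (ℕ.<⇒≤ j≤))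
          (subst (cells R) (sym (shift-at-⊕ (corner R) i j 0 1)) (cell-inside R i≤ j≤)))
    lemma : ∀ {p} → cells R p → Offsets R p → cells Q p
    lemma _ (offsets l b i i′ j j′) = cell i j (ℕ.m≤m+n i i′) (ℕ.m≤m+n j j′)

  interval-equal : ∀ {l r r′} → ℤ.+ r ℤ.+ l ≡ ℤ.+ r′ ℤ.+ l → r ≡ r′
  interval-equal {l} {r} {r′} eq = ℤ.+-injective (∙-cancelʳ l (ℤ.+ r) (ℤ.+ r′) eq)

  ⊑-antisym : ∀ {Q R} → Q ⊑ R → R ⊑ Q → Q ≡ R
  ⊑-antisym {Q@(rect l b r v)} {R@(rect l′ b′ r′ v′)} Q⊑R R⊑Q
    with refl ← ℤ.≤-antisym (proj₁ (proj₁ (R⊑Q (corner∈ R)))) (proj₁ (proj₁ (Q⊑R (corner∈ Q))))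
       | refl ← ℤ.≤-antisym (proj₁ (proj₂ (R⊑Q (corner∈ R)))) (proj₁ (proj₂ (Q⊑R (corner∈ Q))))
    with refl ← interval-equal {l} {r} {r′}
        (ℤ.≤-antisym (proj₂ (proj₁ (Q⊑R (far-corner∈ Q)))) (proj₂ (proj₁ (R⊑Q (far-corner∈ R)))))
       | refl ← interval-equal {b} {v} {v′}
           (ℤ.≤-antisym (proj₂ (proj₂ (Q⊑R (far-corner∈ Q))))
           (proj₂ (proj₂ (R⊑Q (far-corner∈ R))))) = refl

  -- The union determines the family: R lies in some Q of L′, which lies in some T of L; T meets R,
  -- so T is R, and Q is squeezed between them.
  separated-⊆ : ∀ {L L′} → Separated L → Separated L′ → Covers L L′ → Covers L′ L → ∀ {R} → R ∈ L →
      R ∈ L′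
  separated-⊆ {L} {L′} sep sep′ L⊇L′ L′⊇L {R} R∈L
    with Q , Q∈L′ , R⊑Q ← contained R sep′ (λ p∈R → L′⊇L (lose R∈L p∈R))
    with T , T∈L , Q⊑T ← contained Q sep (λ p∈Q → L⊇L′ (lose Q∈L′ p∈Q))
    with refl ← separated-unique stay sep R∈L T∈L (corner∈ R)
        (subst (cells T) (sym (⊕-stay (corner R))) (Q⊑T (R⊑Q (corner∈ R))))
    = subst (_∈ L′) (⊑-antisym Q⊑T R⊑Q) Q∈L′

  -- Both normal forms consist of the same rectangles. Inclusion of their coins as sets suffices to
  -- pass from one to the other, as reordering is free.
  mutual-reach : ∀ {X Y c} → Spans X Y → Spans Y X → 2 + length X ≤ c → 2 + length Y ≤ c →
      X ⇒[ c ] Y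
  mutual-reach {X} {Y} X⇛Y Y⇛X X≤ Y≤
    with L , sep , X⊆L , X↘L ← normalise X
       | L′ , sep′ , Y⊆L′ , Y↘L′ ← normalise Y
    = cap-mono X≤ (forth X↘L) ◅◅ ⊆⇒ L′⊆L ◅◅ cap-mono Y≤ (back Y↘L′)
    where
    L⊆ : Covers L′ L
    L⊆ = covered-spanned X↘L (covered-closed sep′) (Y⇛X (covered-closed sep′) Y⊆L′)
    L′⊆ : Covers L L′
    L′⊆ = covered-spanned Y↘L′ (covered-closed sep) (X⇛Y (covered-closed sep) X⊆L)
    L′⊆L : skeletons L′ ⊆ skeletons L
    L′⊆L p∈ with R , R∈L′ , p∈R ← find (∈-concatMap⁻ skeleton {xs = L′} p∈) =
      skeletons∈ (separated-⊆ sep′ sep L⊆ L′⊆ R∈L′) p∈R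

  -- Normalising X does not increase the number of coins, and R must be among the resulting
  -- rectangles.
  skeleton-minimal : ∀ {X} R → Spans X (skeleton R) → Spans (skeleton R) X →
      length (skeleton R) ≤ length X
  skeleton-minimal {X} R X⇛R R⇛X with L , sep , X⊆L , X↘L ← normalise X =
    ≤-trans (length-skeletons (separated-⊆ ([] ∷ []) sep R⊆L L⊆R (here refl))) (shrinks X↘L)
    where
    L⊆R : Covers L [ R ]
    L⊆R (here p∈R) = skeleton-spans R (covered-closed sep) (X⇛R (covered-closed sep) X⊆L) p∈R
    R⊆L : Covers [ R ] L
    R⊆L p∈L = here (covered-spanned X↘L (cells-closed R) (R⇛X (cells-closed R) (skeleton⊆cells R))
        p∈L)
    length-skeletons : ∀ {L R} → R ∈ L → length (skeleton R) ≤ length (skeletons L)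
    length-skeletons {Q ∷ L} (here refl) =
        ≤-trans (ℕ.m≤m+n _ _) (≤-reflexive (sym (length-++ (skeleton Q))))
    length-skeletons {Q ∷ L} (there R∈L) =
        ≤-trans (length-skeletons R∈L) (≤-trans (ℕ.m≤n+m _ (length (skeleton Q)))
        (≤-reflexive (sym (length-++ (skeleton Q)))))

  -- From tracked sets to legal moves of configurations

  unique-↭ : ∀ {X Y : List Position} → X ↭ Y → Unique X → Unique Y
  unique-↭ X↭Y = ↭ₛ.Unique-resp-↭ (setoid Position) (↭⇒↭ₛ X↭Y)

  unique-⊆-length : ∀ {X Y : List Position} → Unique X → X ⊆ Y → length X ≤ length Y
  unique-⊆-length {[]} _ _ = z≤n
  unique-⊆-length {x ∷ X} (x∉X ∷ uX) X⊆Y with as , bs , refl ← ∈-∃++ (X⊆Y (here refl)) =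
    ≤-trans (s≤s (unique-⊆-length uX X⊆)) (≤-reflexive (sym (↭-length (↭-shift x as bs))))
    where
    X⊆ : X ⊆ as ++ bs
    X⊆ p∈X with ∈-resp-↭ (↭-shift x as bs) (X⊆Y (there p∈X))
    ... | here refl = ⊥-elim (All.lookup x∉X p∈X refl)
    ... | there p∈  = p∈

  spare-coin : ∀ {A X : List Position} → Unique A → length X < length A → ∃[ c ] c ∈ A × c ∉ X
  spare-coin {A} {X} uA X<A with All.all? (_∈? X) A
  ... | yes A⊆X = ⊥-elim (ℕ.<⇒≱ X<A (unique-⊆-length uA (All.lookup A⊆X)))
  ... | no  A⊈X = find (¬All⇒Any¬ (_∈? X) A A⊈X)

  not-own-neighbor : ∀ {p q} → q ∈ neighbors p → q ≢ p
  not-own-neighbor to-west  eq with () ← identityˡ-unique ℤ.-1ℤ _ (cong proj₁ eq)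
  not-own-neighbor to-east  eq with () ← identityˡ-unique ℤ.1ℤ _ (cong proj₁ eq)
  not-own-neighbor to-north eq with () ← identityˡ-unique ℤ.1ℤ _ (cong proj₂ eq)
  not-own-neighbor to-south eq with () ← identityˡ-unique ℤ.-1ℤ _ (cong proj₂ eq)

  -- By counting, A has a coin c outside X. Moving c to p leaves X intact, in particular the two
  -- supports of p.
  realise-grow : ∀ (A : Configuration) {X p} → X ⊆ coins A → length X < ∣ A ∣ → Supported p X →
      p ∉ coins A →
    ∃[ A′ ] A ⟶ A′ × ∣ A′ ∣ ≡ ∣ A ∣ × p ∷ X ⊆ coins A′
  realise-grow A {X} {p} X⊆A X<A s p∉A
    with c , c∈A , c∉X ← spare-coin (unique A) X<A
    with as , bs , eq ← ∈-∃++ c∈A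
    = A′ , (c , p , c∈A , p∉A , twoNeighbors-mono kept s , (λ {q} → moved {q}) ,
        (λ {q} → unmoved {q}))
    , sym (↭-length A↭) , λ { (here refl) → here refl ; (there q∈X) →
        there (rest (X⊆A q∈X) λ { refl → c∉X q∈X }) }
    where
    A↭ : coins A ↭ c ∷ (as ++ bs)
    A↭ = subst (_↭ c ∷ (as ++ bs)) (sym eq) (↭-shift c as bs)
    rest : ∀ {q} → q ∈ coins A → c ≢ q → q ∈ as ++ bs
    rest q∈A c≢q with ∈-resp-↭ A↭ q∈A
    ... | here q≡c = ⊥-elim (c≢q (sym q≡c))
    ... | there q∈ = q∈
    unique′ : Unique (c ∷ (as ++ bs))
    unique′ = unique-↭ A↭ (unique A)
    old : ∀ {q} → q ∈ as ++ bs → q ∈ coins A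
    old q∈ = ∈-resp-↭ (↭-sym A↭) (there q∈)
    A′ : Configuration
    A′ = config (p ∷ (as ++ bs)) (¬Any⇒All¬ _ (λ p∈ → p∉A (old p∈)) ∷ AllPairs.tail unique′)
    kept : ∀ {q} → q ∈ X → q ∈ coins A × ¬ (c ≡ q)
    kept q∈X = X⊆A q∈X , λ { refl → c∉X q∈X }
    moved : ∀ {q} → q ∈ p ∷ (as ++ bs) → (q ∈ coins A × ¬ (c ≡ q)) ⊎ (p ≡ q)
    moved (here refl) = inj₂ refl
    moved (there q∈) = inj₁ (old q∈ , All.lookup (AllPairs.head unique′) q∈)
    unmoved : ∀ {q} → (q ∈ coins A × ¬ (c ≡ q)) ⊎ (p ≡ q) → q ∈ p ∷ (as ++ bs)
    unmoved (inj₁ (q∈A , c≢q)) = there (rest q∈A c≢q)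
    unmoved (inj₂ refl)        = here refl

  realise : ∀ {N X Y} (A : Configuration) → ∣ A ∣ ≡ N → X ⊆ coins A → X ⇒[ N ] Y →
    ∃[ A′ ] Star _⟶_ A A′ × ∣ A′ ∣ ≡ N × Y ⊆ coins A′
  realise A ∣A∣≡N X⊆A ε = A , ε , ∣A∣≡N , X⊆A
  realise A ∣A∣≡N X⊆A (weaken Y⊆X ◅ ss) = realise A ∣A∣≡N (X⊆A ∘ Y⊆X) ss
  realise A ∣A∣≡N X⊆A (grow {p} X<N s ◅ ss) with p ∈? coins A
  -- A coin of A is already at p, so no move is made and it only becomes tracked.
  ... | yes p∈A = realise A ∣A∣≡N (λ { (here refl) → p∈A ; (there q∈X) → X⊆A q∈X }) ss
  ... | no p∉A
    with A₁ , A⟶A₁ , ∣A₁∣ , pX⊆A₁ ← realise-grow A X⊆A (≤-trans X<N (≤-reflexive (sym ∣A∣≡N))) s p∉A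
    with A′ , A₁⟶A′ , ∣A′∣ , Y⊆A′ ← realise A₁ (trans ∣A₁∣ ∣A∣≡N) pX⊆A₁ ss
    = A′ , A⟶A₁ ◅ A₁⟶A′ , ∣A′∣ , Y⊆A′

  unique-full : ∀ {X Y : List Position} → Unique X → Unique Y → length X ≡ length Y → X ⊆ Y → Y ⊆ X
  unique-full {X} uX uY eq X⊆Y {q} q∈Y with q ∈? X
  ... | yes q∈X = q∈X
  ... | no q∉X  = ⊥-elim (ℕ.<⇒≱ (≤-reflexive (cong suc (sym eq)))
    (unique-⊆-length {q ∷ X} (¬Any⇒All¬ _ q∉X ∷ uX)
        λ { (here refl) → q∈Y ; (there p∈X) → X⊆Y p∈X }))

  realise-configuration : ∀ {N X} (A B : Configuration) → ∣ A ∣ ≡ N → ∣ B ∣ ≡ N →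
    X ⊆ coins A → X ⇒[ N ] coins B → A ⟶* B
  realise-configuration A B ∣A∣ ∣B∣ X⊆A X⇒B with A′ , A⟶A′ , ∣A′∣ , B⊆A′ ← realise A ∣A∣ X⊆A X⇒B =
    A′ , A⟶A′ , (λ {q} → unique-full (unique B) (unique A′) (trans ∣B∣ (sym ∣A′∣)) B⊆A′ {q}) ,
        (λ {q} → B⊆A′ {q})

  -- Spans

  span⊆closed : ∀ {S C : PositionSet} → Closed C → (∀ {p} → S p → C p) → ∀ {p} → span S p → C p
  span⊆closed {S} {C} closed S⊆C (i , eventually) = growth⊆ i (eventually i ≤-refl)
    where
    growth⊆ : ∀ i {p} → growth S i p → C p
    growth⊆ zero p∈                = S⊆C p∈
    growth⊆ (suc i) (inj₁ p∈)      = growth⊆ i p∈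
    growth⊆ (suc i) (inj₂ (_ , s)) = closed (twoNeighbors-mono (growth⊆ i) s)

  ⊆span : ∀ {S : PositionSet} {p} → S p → span S p
  ⊆span {S} {p} p∈S = 0 , λ j _ → grown j
    where
    grown : ∀ j → growth S j p
    grown zero    = p∈S
    grown (suc j) = inj₁ (grown j)

  infixl 6 _∖ˡ_

  _∖ˡ_ : List Position → List Position → List Position
  X ∖ˡ Y = filter (λ p → ¬? (p ∈? Y)) X

  ∖ˡ-length : ∀ {X Y} → Unique X → Unique Y → Y ⊆ X → length Y + length (X ∖ˡ Y) ≤ length X
  ∖ˡ-length {X} {Y} uX uY Y⊆X = ≤-trans (≤-reflexive (sym (length-++ Y)))
    (unique-⊆-length (Unique.++⁺ uY (Unique.filter⁺ _ uX)
        (λ (p∈Y , p∈) → proj₂ (∈-filter⁻ _ {xs = X} p∈) p∈Y)) ⊆X)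
    where
    ⊆X : Y ++ X ∖ˡ Y ⊆ X
    ⊆X p∈ with ∈-++⁻ Y p∈
    ... | inj₁ p∈Y = Y⊆X p∈Y
    ... | inj₂ p∈  = proj₁ (∈-filter⁻ _ p∈)

  -- Together with the upper bound below, this pins the length to ⌈(r + v)/2⌉ + 1 in a form without
  -- division.
  chain-length-lower : ∀ r v → 2 + (r + v) ≤ 2 * length (chain r v)
  chain-length-lower r v = ≤-trans (bound r v) (≤-reflexive (double (length (chain r v))))
    where
    double : ∀ n → n + n ≡ 2 * n
    double = ℕ.solve-∀
    step : ∀ p s X {k} → 2 + k ≤ length X + length X →
        2 + (2 + k) ≤ length (p ∷ map (shift s) X) + length (p ∷ map (shift s) X)
    step p s X {k} le rewrite length-map (shift s) X | ℕ.+-suc (length X) (length X) = s≤s (s≤s le)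
    bound : ∀ r v → 2 + (r + v) ≤ length (chain r v) + length (chain r v)
    bound 0 0             = s≤s (s≤s z≤n)
    bound 0 1             = s≤s (s≤s (s≤s z≤n))
    bound 0 (suc (suc v)) = step (at 0 0) (at 0 2) (chain 0 v) (bound 0 v)
    bound 1 0             = s≤s (s≤s (s≤s z≤n))
    bound 1 (suc v)       = step (at 0 0) (at 1 1) (chain 0 v) (bound 0 v)
    bound (suc (suc r)) v = step (at 0 0) (at 2 0) (chain r v) (bound r v)

  chain-length-upper : ∀ r v → 2 * length (chain r v) ≤ 3 + (r + v)
  chain-length-upper r v = ≤-trans (≤-reflexive (double (length (chain r v)))) (bound r v)
    where
    double : ∀ n → 2 * n ≡ n + n
    double = ℕ.solve-∀
    step : ∀ p s X {k} → length X + length X ≤ 3 + k →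
        length (p ∷ map (shift s) X) + length (p ∷ map (shift s) X) ≤ 3 + (2 + k)
    step p s X {k} le rewrite length-map (shift s) X | ℕ.+-suc (length X) (length X) = s≤s (s≤s le)
    bound : ∀ r v → length (chain r v) + length (chain r v) ≤ 3 + (r + v)
    bound 0 0             = s≤s (s≤s z≤n)
    bound 0 1             = ≤-refl
    bound 0 (suc (suc v)) = step (at 0 0) (at 0 2) (chain 0 v) (bound 0 v)
    bound 1 0             = ≤-refl
    bound 1 (suc v)       = step (at 0 0) (at 1 1) (chain 0 v) (bound 0 v)
    bound (suc (suc r)) v = step (at 0 0) (at 2 0) (chain r v) (bound r v)

  skeleton-length : ∀ R → length (skeleton R) ≡ length (chain (width R) (height R))
  skeleton-length R = length-map _ (chain (width R) (height R))

  -- Coins inside and outside a rectangle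

  inside outside : Rect → List Position → List Position
  inside Q  = filter (cells? Q)
  outside Q = filter (λ p → ¬? (cells? Q p))

  module _ {P : PositionSet} (P? : Decidable P) where

    filter-complement : ∀ X → length (filter (λ p → ¬? (P? p)) X) + length (filter P? X) ≡ length X
    filter-complement [] = refl
    filter-complement (p ∷ X) with P? p
    ... | yes _ = trans (ℕ.+-suc _ _) (cong suc (filter-complement X))
    ... | no _  = cong suc (filter-complement X)

  filter-length-mono : {P Q : PositionSet} (P? : Decidable P) (Q? : Decidable Q) →
      (∀ {p} → P p → Q p) →
    ∀ X → length (filter P? X) ≤ length (filter Q? X)
  filter-length-mono P? Q? P⊆Q [] = z≤n
  filter-length-mono P? Q? P⊆Q (p ∷ X) with P? p | Q? p
  ... | no _   | no _  = filter-length-mono P? Q? P⊆Q X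
  ... | no _   | yes _ = ℕ.m≤n⇒m≤1+n (filter-length-mono P? Q? P⊆Q X)
  ... | yes _  | yes _ = s≤s (filter-length-mono P? Q? P⊆Q X)
  ... | yes Pp | no ¬Q = ⊥-elim (¬Q (P⊆Q Pp))

  module _ {P Q R : PositionSet} (P? : Decidable P) (Q? : Decidable Q) (R? : Decidable R)
    (cover : ∀ {p} → P p → Q p ⊎ R p) where

    filter-cover : ∀ X → length (filter P? X) ≤ length (filter Q? X) + length (filter R? X)
    filter-cover [] = z≤n
    filter-cover (p ∷ X) with P? p | Q? p | R? p
    ... | no _   | no _  | no _  = filter-cover X
    ... | no _   | no _  | yes _ = ≤-trans (filter-cover X)
        (ℕ.+-monoʳ-≤ (length (filter Q? X)) (ℕ.n≤1+n _))
    ... | no _   | yes _ | no _  = ℕ.m≤n⇒m≤1+n (filter-cover X)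
    ... | no _   | yes _ | yes _ = ℕ.m≤n⇒m≤1+n
        (≤-trans (filter-cover X) (ℕ.+-monoʳ-≤ (length (filter Q? X)) (ℕ.n≤1+n _)))
    ... | yes _  | yes _ | no _  = s≤s (filter-cover X)
    ... | yes _  | yes _ | yes _ = s≤s
        (≤-trans (filter-cover X) (ℕ.+-monoʳ-≤ (length (filter Q? X)) (ℕ.n≤1+n _)))
    ... | yes _  | no _  | yes _ = ≤-trans (s≤s (filter-cover X)) (≤-reflexive (sym (ℕ.+-suc _ _)))
    ... | yes Pp | no ¬Q | no ¬R with cover Pp
    ...   | inj₁ Qp = ⊥-elim (¬Q Qp)
    ...   | inj₂ Rp = ⊥-elim (¬R Rp)

  Halved : List Position → Rect → ℕ → ℕ → Set
  Halved X Q r v = ∃[ Q′ ] Q′ ⊑ Q × width Q′ ≡ r × height Q′ ≡ v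
      × length (inside Q X) ≤ 2 * length (inside Q′ X)

  larger-half : ∀ {X Q r v} Q₁ Q₂ → Q₁ ⊑ Q → Q₂ ⊑ Q → width Q₁ ≡ r → height Q₁ ≡ v → width Q₂ ≡ r →
      height Q₂ ≡ v →
    (∀ {p} → cells Q p → cells Q₁ p ⊎ cells Q₂ p) → Halved X Q r v
  larger-half {X} {Q} Q₁ Q₂ ⊑₁ ⊑₂ r₁ v₁ r₂ v₂ cover with ℕ.≤-total (length (inside Q₁ X))
      (length (inside Q₂ X))
  ... | inj₁ le = Q₂ , ⊑₂ , r₂ , v₂ , ≤-trans
      (filter-cover (cells? Q) (cells? Q₁) (cells? Q₂) cover X)
    (≤-trans (ℕ.+-monoˡ-≤ (length (inside Q₂ X)) le)
        (≤-reflexive (cong (length (inside Q₂ X) +_) (sym (ℕ.+-identityʳ _)))))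
  ... | inj₂ ge = Q₁ , ⊑₁ , r₁ , v₁ , ≤-trans
      (filter-cover (cells? Q) (cells? Q₁) (cells? Q₂) cover X)
    (≤-trans (ℕ.+-monoʳ-≤ (length (inside Q₁ X)) ge)
        (≤-reflexive (cong (length (inside Q₁ X) +_) (sym (ℕ.+-identityʳ _)))))

  Within : ℤ → ℕ → ℤ → Set
  Within l r x = l ℤ.≤ x × x ℤ.≤ ℤ.+ r ℤ.+ l

  lower-half : ∀ {l r x} → Within l ⌊ r /2⌋ x → Within l r x
  lower-half {l} {r} (≤x , x≤) = ≤x , ℤ.≤-trans x≤ (ℤ.+-monoˡ-≤ l (ℤ.+≤+ (ℕ.⌊n/2⌋≤n r)))

  upper-half : ∀ {l r x} → Within (ℤ.+ ⌈ r /2⌉ ℤ.+ l) ⌊ r /2⌋ x → Within l r x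
  upper-half {l} {r} (≤x , x≤) = ℤ.≤-trans (proj₁ (interval-inside {⌈ r /2⌉} {r} l (ℕ.⌈n/2⌉≤n r)))
      ≤x
    , ℤ.≤-trans x≤ (ℤ.≤-reflexive (trans (sym (ℤ.+-assoc (ℤ.+ ⌊ r /2⌋) (ℤ.+ ⌈ r /2⌉) l))
        (cong (λ k → ℤ.+ k ℤ.+ l) (ℕ.⌊n/2⌋+⌈n/2⌉≡n r))))

  -- An interval has r + 1 elements, and both halves have ⌊r/2⌋ + 1. For even r they share the
  -- middle element, which keeps their sizes equal.
  halves : ∀ {l r x} → Within l r x → Within l ⌊ r /2⌋ x ⊎ Within (ℤ.+ ⌈ r /2⌉ ℤ.+ l) ⌊ r /2⌋ x
  halves {l} {r} (≤x , x≤) with i , i′ , refl , refl ←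
      interval-offset ≤x x≤ with i ℕ.≤? ⌊ (i + i′) /2⌋
  ... | yes i≤ = inj₁ (interval-inside l i≤)
  ... | no i≰  = inj₂ (ℤ.+-monoˡ-≤ l (ℤ.+≤+ ⌈⌉≤i)
    , ℤ.≤-trans x≤ (ℤ.≤-reflexive (trans (cong (λ k → ℤ.+ k ℤ.+ l) (sym (ℕ.⌊n/2⌋+⌈n/2⌉≡n r)))
        (ℤ.+-assoc (ℤ.+ ⌊ r /2⌋) (ℤ.+ ⌈ r /2⌉) l))))
    where
    ⌈⌉≤1+⌊⌋ : ∀ n → ⌈ n /2⌉ ≤ suc ⌊ n /2⌋
    ⌈⌉≤1+⌊⌋ 0             = z≤n
    ⌈⌉≤1+⌊⌋ 1             = ≤-refl
    ⌈⌉≤1+⌊⌋ (suc (suc n)) = s≤s (⌈⌉≤1+⌊⌋ n)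
    ⌈⌉≤i : ⌈ (i + i′) /2⌉ ≤ i
    ⌈⌉≤i = ≤-trans (⌈⌉≤1+⌊⌋ (i + i′)) (ℕ.≰⇒> i≰)

  halve-width : ∀ X Q → Halved X Q ⌊ width Q /2⌋ (height Q)
  halve-width X Q@(rect l b r v) =
      larger-half {X} {Q} (rect l b ⌊ r /2⌋ v) (rect (ℤ.+ ⌈ r /2⌉ ℤ.+ l) b ⌊ r /2⌋ v)
    (λ (x , y) → lower-half {l} {r} x , y) (λ (x , y) → upper-half {l} {r} x , y) refl refl refl
        refl
    λ (x , y) → Sum.map (_, y) (_, y) (halves x)

  halve-height : ∀ X Q → Halved X Q (width Q) ⌊ height Q /2⌋
  halve-height X Q@(rect l b r v) =
      larger-half {X} {Q} (rect l b r ⌊ v /2⌋) (rect l (ℤ.+ ⌈ v /2⌉ ℤ.+ b) r ⌊ v /2⌋)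
    (λ (x , y) → x , lower-half {b} {v} y) (λ (x , y) → x , upper-half {b} {v} y) refl refl refl
        refl
    λ (x , y) → Sum.map (x ,_) (x ,_) (halves y)

  -- Halving the longer side first makes the half at most 3/4 of the half-perimeter.
  record Quartering (X : List Position) (R : Rect) : Set where
    field
      half quarter   : Rect
      half⊑          : half ⊑ R
      quarter⊑       : quarter ⊑ half
      half-size      : 4 * (width half + height half) ≤ 3 * (width R + height R)
      quarter-size   : 2 * (width quarter + height quarter) ≤ width R + height R
      half-inside    : length (inside R X) ≤ 2 * length (inside half X)
      quarter-inside : length (inside half X) ≤ 2 * length (inside quarter X)

  2⌊n/2⌋≤n : ∀ n → 2 * ⌊ n /2⌋ ≤ n
  2⌊n/2⌋≤n n = ≤-trans (ℕ.+-monoʳ-≤ ⌊ n /2⌋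
      (≤-trans (≤-reflexive (ℕ.+-identityʳ _)) (ℕ.⌊n/2⌋≤⌈n/2⌉ n))) (≤-reflexive (ℕ.⌊n/2⌋+⌈n/2⌉≡n n))

  half-bound : ∀ {a b} h → 2 * h ≤ a → b ≤ a → 4 * (h + b) ≤ 3 * (a + b)
  half-bound {a} {b} h 2h≤a b≤a = subst₂ _≤_ (lhs h b) (rhs a b)
    (ℕ.+-mono-≤ (ℕ.*-monoʳ-≤ 2 2h≤a) (ℕ.+-monoʳ-≤ (3 * b) b≤a))
    where
    lhs : ∀ h b → 2 * (2 * h) + (3 * b + b) ≡ 4 * (h + b)
    lhs = ℕ.solve-∀
    rhs : ∀ a b → 2 * a + (3 * b + a) ≡ 3 * (a + b)
    rhs = ℕ.solve-∀

  quarter-bound : ∀ a b → 2 * (⌊ a /2⌋ + ⌊ b /2⌋) ≤ a + b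
  quarter-bound a b = ≤-trans (≤-reflexive (ℕ.*-distribˡ-+ 2 ⌊ a /2⌋ ⌊ b /2⌋))
      (ℕ.+-mono-≤ (2⌊n/2⌋≤n a) (2⌊n/2⌋≤n b))

  quartering : ∀ X R → Quartering X R
  quartering X R with ℕ.≤-total (height R) (width R)
  ... | inj₁ h≤w
    with H , H⊑R , refl , refl , R≤H ← halve-width X R
    with Q , Q⊑H , refl , refl , H≤Q ← halve-height X H = record
    { half = H ; quarter = Q ; half⊑ = H⊑R ; quarter⊑ = Q⊑H
    ; half-size = half-bound ⌊ width R /2⌋ (2⌊n/2⌋≤n (width R)) h≤w
    ; quarter-size = quarter-bound (width R) (height R)
    ; half-inside = R≤H ; quarter-inside = H≤Q }
  ... | inj₂ w≤h
    with H , H⊑R , refl , refl , R≤H ← halve-height X R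
    with Q , Q⊑H , refl , refl , H≤Q ← halve-width X H = record
    { half = H ; quarter = Q ; half⊑ = H⊑R ; quarter⊑ = Q⊑H
    ; half-size = subst₂ (λ s t → 4 * s ≤ 3 * t) (ℕ.+-comm ⌊ height R /2⌋ (width R))
        (ℕ.+-comm (height R) (width R))
        (half-bound ⌊ height R /2⌋ (2⌊n/2⌋≤n (height R)) w≤h)
    ; quarter-size = quarter-bound (width R) (height R)
    ; half-inside = R≤H ; quarter-inside = H≤Q }

  -- Linear combinations of inequalities: c collects the terms common to both sides, so that no
  -- subtraction occurs.
  cancel-linear : ∀ d e c {x y A B} → e < d → A ≤ B → A ≡ c + d * x → B ≡ c + (d * y + e) → x ≤ y
  cancel-linear d@(suc _) e c {x} {y} e<d A≤B refl refl =
    ℕ.s≤s⁻¹ (ℕ.*-cancelˡ-< d x (suc y) (ℕ.≤-<-trans (ℕ.+-cancelˡ-≤ c _ _ A≤B)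
      (ℕ.<-≤-trans (ℕ.+-monoʳ-< (d * y) e<d)
          (≤-reflexive (trans (ℕ.+-comm (d * y) d) (sym (ℕ.*-suc d y)))))))

  -- M is the larger minimum, K the number of coins without the two spare ones, k the length of the
  -- chain of R, and b the size of P.
  module Budget {M K k b : ℕ} (3M≤2K : 3 * M ≤ 2 * K) (k≤M : k ≤ M) (b≤M : b ≤ M) where

    ≤M⇒≤K : ∀ {x} → x ≤ M → x ≤ K
    ≤M⇒≤K x≤M = ℕ.*-cancelˡ-≤ 2 (≤-trans (ℕ.*-monoʳ-≤ 2 x≤M)
        (≤-trans (ℕ.*-monoˡ-≤ M (ℕ.n≤1+n 2)) 3M≤2K))

    -- At most b/2 coins are outside, and k + b/2 ≤ 3M/2 ≤ K.
    last-fits : ∀ {out ins} → out + ins ≡ b → b ≤ 2 * ins → k + out ≤ K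
    last-fits {out} {ins} refl half = cancel-linear 2 0 (2 * ins + 3 * M) (s≤s z≤n)
      (ℕ.+-mono-≤ (ℕ.*-monoʳ-≤ 2 k≤M) (ℕ.+-mono-≤ half (ℕ.+-mono-≤ b≤M 3M≤2K)))
      (lhs k out ins M) (rhs ins M K)
      where
      lhs : ∀ k out ins M → 2 * k + ((out + ins) + ((out + ins) + 3 * M))
          ≡ 2 * ins + 3 * M + 2 * (k + out)
      lhs = ℕ.solve-∀
      rhs : ∀ ins M K → 2 * M + (2 * ins + (M + 2 * K)) ≡ 2 * ins + 3 * M + (2 * K + 0)
      rhs = ℕ.solve-∀

    -- Here q ≤ 3/2 + s₂/2 ≤ 3/2 + 3s/8 ≤ 3(k + 1)/4 and out ≤ 3b/4, so the sum is at most K + 3/4.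
    -- Integrality removes the 3/4, which is the remainder 6 against the divisor 8.
    middle-fits : ∀ {out ins q s s₂} → 2 * q ≤ 3 + s₂ → 4 * s₂ ≤ 3 * s → 2 + s ≤ 2 * k →
      out + ins ≡ b → b ≤ 4 * ins → q + out ≤ K
    middle-fits {out} {ins} {q} {s} {s₂} q≤ s₂≤ s≤ refl quarter =
      cancel-linear 8 6 (4 * s₂ + 6 + 3 * s + 6 * k + 8 * ins + 12 * M) (ℕ.n≤1+n 7)
        (ℕ.+-mono-≤ (ℕ.*-monoʳ-≤ 4 q≤) (ℕ.+-mono-≤ s₂≤
            (ℕ.+-mono-≤ (ℕ.*-monoʳ-≤ 3 s≤) (ℕ.+-mono-≤ (ℕ.*-monoʳ-≤ 6 k≤M)
          (ℕ.+-mono-≤ (ℕ.*-monoʳ-≤ 2 quarter)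
              (ℕ.+-mono-≤ (ℕ.*-monoʳ-≤ 6 b≤M) (ℕ.*-monoʳ-≤ 4 3M≤2K)))))))
        (lhs out ins q s s₂ k M) (rhs ins s s₂ k M K)
      where
      lhs : ∀ out ins q s s₂ k M →
        4 * (2 * q) + (4 * s₂ + (3 * (2 + s) +
            (6 * k + (2 * (out + ins) + (6 * (out + ins) + 4 * (3 * M))))))
        ≡ 4 * s₂ + 6 + 3 * s + 6 * k + 8 * ins + 12 * M + 8 * (q + out)
      lhs = ℕ.solve-∀
      rhs : ∀ ins s s₂ k M K →
        4 * (3 + s₂) + (3 * s + (3 * (2 * k) + (6 * M + (2 * (4 * ins) + (6 * M + 4 * (2 * K))))))
        ≡ 4 * s₂ + 6 + 3 * s + 6 * k + 8 * ins + 12 * M + (8 * K + 6)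
      rhs = ℕ.solve-∀

    -- Here q ≤ 3/2 + s/4 ≤ k/2 + 1. The excess 1 is paid for by the coin of P that is not outside.
    first-fits : ∀ {out q s s₁} → 2 * q ≤ 3 + s₁ → 2 * s₁ ≤ s → 2 + s ≤ 2 * k → suc out ≤ b →
        q + out ≤ K
    first-fits {out} {q} {s} {s₁} q≤ s₁≤ s≤ out<b =
      cancel-linear 4 0 (2 * s₁ + 6 + s + 2 * k + 6 * M) (s≤s z≤n)
        (ℕ.+-mono-≤ (ℕ.*-monoʳ-≤ 2 q≤) (ℕ.+-mono-≤ s₁≤
            (ℕ.+-mono-≤ s≤ (ℕ.+-mono-≤ (ℕ.*-monoʳ-≤ 2 k≤M)
          (ℕ.+-mono-≤ (ℕ.*-monoʳ-≤ 4 (≤-trans out<b b≤M)) (ℕ.*-monoʳ-≤ 2 3M≤2K))))))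
        (lhs out q s s₁ k M) (rhs s s₁ k M K)
      where
      lhs : ∀ out q s s₁ k M →
        2 * (2 * q) + (2 * s₁ + (2 + s + (2 * k + (4 * suc out + 2 * (3 * M)))))
        ≡ 2 * s₁ + 6 + s + 2 * k + 6 * M + 4 * (q + out)
      lhs = ℕ.solve-∀
      rhs : ∀ s s₁ k M K →
        2 * (3 + s₁) + (s + (2 * k + (2 * M + (4 * M + 2 * (2 * K)))))
        ≡ 2 * s₁ + 6 + s + 2 * k + 6 * M + (4 * K + 0)
      rhs = ℕ.solve-∀

  -- Descending through nested rectangles

  skeleton-++-spans : ∀ Q {X Y} → (∀ {p} → p ∈ Y → cells Q p ⊎ p ∈ X) →
      Spans (skeleton Q ++ X) (skeleton Q ++ Y)
  skeleton-++-spans Q {X} {Y} Y⊆ {C} closed ⊆C p∈ with ∈-++⁻ (skeleton Q) p∈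
  ... | inj₁ p∈Q = ⊆C (∈-++⁺ˡ p∈Q)
  ... | inj₂ p∈Y with Y⊆ p∈Y
  ...   | inj₁ p∈Q = skeleton-spans Q {C} closed (⊆C ∘ ∈-++⁺ˡ) p∈Q
  ...   | inj₂ p∈X = ⊆C (∈-++⁺ʳ (skeleton Q) p∈X)

  outside∈ : ∀ Q X {p} → p ∈ X → ¬ cells Q p → p ∈ outside Q X
  outside∈ Q X = ∈-filter⁺ (λ p → ¬? (cells? Q p))

  ∈outside : ∀ Q X {p} → p ∈ outside Q X → p ∈ X × ¬ cells Q p
  ∈outside Q X = ∈-filter⁻ (λ p → ¬? (cells? Q p)) {xs = X}

  outside-antitone : ∀ {Q R} X → Q ⊑ R → outside R X ⊆ outside Q X
  outside-antitone {Q} {R} X Q⊑R p∈ with p∈X , p∉R ← ∈outside R X p∈ = outside∈ Q X p∈X (p∉R ∘ Q⊑R)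

  outside-length-antitone : ∀ {Q R} X → Q ⊑ R → length (outside R X) ≤ length (outside Q X)
  outside-length-antitone {Q} {R} X Q⊑R =
      filter-length-mono (λ p → ¬? (cells? R p)) (λ p → ¬? (cells? Q p)) (_∘ Q⊑R) X

  -- Coins of X in R but outside Q are spanned by the chain of R, so adding them does not change the
  -- span and they can be recovered reversibly. Afterwards they are bystanders while the chain
  -- shrinks to Q.
  descend : ∀ {K} X {Q R} → Q ⊑ R → length (skeleton R) + length (outside Q X) ≤ K →
    skeleton R ++ outside R X ⇒[ 2 + K ] skeleton Q ++ outside Q X
  descend {K} X {Q} {R} Q⊑R ≤K =
      mutual-reach (skeleton-++-spans R inner)
          (skeleton-++-spans R (inj₂ ∘ outside-antitone {Q} {R} X Q⊑R))
        (s≤s (s≤s (≤-trans (≤-trans (≤-reflexive (length-++ (skeleton R)))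
            (ℕ.+-monoʳ-≤ (length (skeleton R)) (outside-length-antitone {Q} {R} X Q⊑R))) ≤K)))
        (s≤s (s≤s (≤-trans (≤-reflexive (length-++ (skeleton R))) ≤K)))
    ◅◅ cap-mono (≤-trans (≤-reflexive (ℕ.+-comm (length (outside Q X)) _)) (s≤s (s≤s ≤K)))
        (frame (outside Q X) (drop (⊑-shrinks Q⊑R)))
    where
    inner : ∀ {p} → p ∈ outside Q X → cells R p ⊎ p ∈ outside R X
    inner {p} p∈ with cells? R p
    ... | yes p∈R = inj₁ p∈R
    ... | no p∉R  = inj₂ (outside∈ R X (proj₁ (∈outside Q X p∈)) p∉R)

  cellᴿ-unique : ∀ {c p} → cells (cellᴿ c) p → p ≡ c
  cellᴿ-unique {x , y} ((≤x , x≤) , (≤y , y≤)) = cong₂ _,_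
    (ℤ.≤-antisym (ℤ.≤-trans x≤ (ℤ.≤-reflexive (ℤ.+-identityˡ x))) ≤x)
    (ℤ.≤-antisym (ℤ.≤-trans y≤ (ℤ.≤-reflexive (ℤ.+-identityˡ y))) ≤y)

  some∈ : ∀ {X : List Position} → 1 ≤ length X → ∃[ p ] p ∈ X
  some∈ {p ∷ _} _ = p , here refl

  module _ {P : List Position} {R : Rect} (q : Quartering P R) where

    open Quartering q

    descend-quarters : ∀ {K M c} → c ∈ P → cells quarter c →
      length P ≤ 2 * length (inside half P) → length P ≤ 4 * length (inside quarter P) →
      3 * M ≤ 2 * K → length (skeleton R) ≤ M → length P ≤ M →
      skeleton R ++ outside R P ⇒[ 2 + K ] skeleton (cellᴿ c) ++ outside (cellᴿ c) P
    descend-quarters {K} {M} {c} c∈P c∈quarter b≤2half b≤4quarter 3M≤2K k≤M b≤M =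
         descend P half⊑ (last-fits {length (outside half P)} {length (inside half P)}
             (filter-complement (cells? half) P) b≤2half)
      ◅◅ descend P quarter⊑ (middle-fits {length (outside quarter P)} {length (inside quarter P)}
          {length (skeleton half)}
           {width R + height R} {width half + height half}
           (upper half) half-size lower (filter-complement (cells? quarter) P) b≤4quarter)
      ◅◅ descend P cell⊑ (first-fits {length (outside (cellᴿ c) P)} {length (skeleton quarter)}
           {width R + height R} {width quarter + height quarter}
           (upper quarter) quarter-size lower
               -- The coin c of P is not outside its own cell, so fewer than all coins of P are.
               (filter-notAll (λ p → ¬? (cells? (cellᴿ c) p)) P
               (lose c∈P λ c∉ → c∉ (corner∈ (cellᴿ c)))))
      where
      open Budget {M} {K} {length (skeleton R)} {length P} 3M≤2K k≤M b≤M
      upper : ∀ Q → 2 * length (skeleton Q) ≤ 3 + (width Q + height Q)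
      upper Q = subst (λ k → 2 * k ≤ 3 + (width Q + height Q)) (sym (skeleton-length Q))
          (chain-length-upper (width Q) (height Q))
      lower : 2 + (width R + height R) ≤ 2 * length (skeleton R)
      lower = subst (λ k → 2 + (width R + height R) ≤ 2 * k) (sym (skeleton-length R))
          (chain-length-lower (width R) (height R))
      cell⊑ : cellᴿ c ⊑ quarter
      cell⊑ p∈ = subst (cells quarter) (sym (cellᴿ-unique p∈)) c∈quarter
  reach-inside : ∀ {K M} R P → (∀ {p} → p ∈ P → cells R p) → 1 ≤ length P →
    3 * M ≤ 2 * K → length (skeleton R) ≤ M → length P ≤ M → skeleton R ⇒[ 2 + K ] P
  reach-inside {K} {M} R P P⊆R nonempty 3M≤2K k≤M b≤M = go (quartering P R)
    where
    start : skeleton R ++ outside R P ⊆ skeleton R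
    start p∈ with ∈-++⁻ (skeleton R) p∈
    ... | inj₁ p∈R = p∈R
    ... | inj₂ p∈o with p∈P , p∉R ← ∈outside R P p∈o = ⊥-elim (p∉R (P⊆R p∈P))
    finish : ∀ c → P ⊆ skeleton (cellᴿ c) ++ outside (cellᴿ c) P
    finish c {p} p∈P = lemma (cells? (cellᴿ c) p)
      where
      lemma : Dec (cells (cellᴿ c) p) → p ∈ skeleton (cellᴿ c) ++ outside (cellᴿ c) P
      lemma (yes p∈c) = here (trans (cellᴿ-unique p∈c) (sym (⊕-stay c)))
      lemma (no p∉c)  = ∈-++⁺ʳ (skeleton (cellᴿ c)) (outside∈ (cellᴿ c) P p∈P p∉c)
    -- The quarter keeps at least a fourth of the nonempty P, hence a coin c at which the descent
    -- can end.
    positive : ∀ k → length P ≤ 4 * k → 1 ≤ k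
    positive 0 b≤0     = ≤-trans nonempty b≤0
    positive (suc _) _ = s≤s z≤n
    go : Quartering P R → skeleton R ⇒[ 2 + K ] P
    go q = from-cell (some∈ (positive (length (inside quarter P)) b≤4quarter))
      where
      open Quartering q
      b≤2half : length P ≤ 2 * length (inside half P)
      b≤2half = ≤-trans (≤-reflexive (cong length (sym (filter-all (cells? R) (All.tabulate P⊆R)))))
          half-inside
      b≤4quarter : length P ≤ 4 * length (inside quarter P)
      b≤4quarter = ≤-trans b≤2half (≤-trans (ℕ.*-monoʳ-≤ 2 quarter-inside)
          (≤-reflexive (sym (ℕ.*-assoc 2 2 (length (inside quarter P))))))
      from-cell : ∃[ c ] c ∈ inside quarter P → skeleton R ⇒[ 2 + K ] P
      from-cell (c , c∈) = ⊆⇒ start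
        ◅◅ descend-quarters q (proj₁ (∈-filter⁻ (cells? quarter) {xs = P} c∈))
            (proj₂ (∈-filter⁻ (cells? quarter) {xs = P} c∈))
             b≤2half b≤4quarter 3M≤2K k≤M b≤M
        ◅◅ ⊆⇒ (finish c)

  -- The hypotheses of the theorem in terms of tracked sets

  interval-bounds : ∀ {a r x} → a ℤ.≤ x × x ℤ.< a ℤ.+ (ℤ.+ suc r) → Within a r x
  interval-bounds {a} {r} (a≤x , x<) =
      a≤x , ℤ.≤-trans (ℤ.i<j⇒i≤pred[j] x<) (ℤ.≤-reflexive (shuffle a (ℤ.+ r)))
    where
    shuffle : ∀ a r → ℤ.-1ℤ ℤ.+ (a ℤ.+ (ℤ.1ℤ ℤ.+ r)) ≡ r ℤ.+ a
    shuffle = ℤ.solve-∀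

  bounds-interval : ∀ {a r x} → Within a r x → a ℤ.≤ x × x ℤ.< a ℤ.+ (ℤ.+ suc r)
  bounds-interval {a} {r} (a≤x , x≤) =
      a≤x , ℤ.i≤pred[j]⇒i<j (ℤ.≤-trans x≤ (ℤ.≤-reflexive (shuffle a (ℤ.+ r))))
    where
    shuffle : ∀ a r → r ℤ.+ a ≡ ℤ.-1ℤ ℤ.+ (a ℤ.+ (ℤ.1ℤ ℤ.+ r))
    shuffle = ℤ.solve-∀

  empty-interval : ∀ {a x} → ¬ (a ℤ.≤ x × x ℤ.< a ℤ.+ (ℤ.+ 0))
  empty-interval {a} (a≤x , x<) = ℤ.<⇒≱ x< (ℤ.≤-trans (ℤ.≤-reflexive (ℤ.+-identityʳ a)) a≤x)

  rectangle : ∀ {m n S p} → IsRectangle m n S → S p → ∃[ R ] S ≐ cells R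
  rectangle {zero} (a , b , S⊆ , _) p∈S = ⊥-elim (empty-interval (proj₁ (S⊆ p∈S)))
  rectangle {suc r} {zero} (a , b , S⊆ , _) p∈S = ⊥-elim (empty-interval (proj₂ (S⊆ p∈S)))
  rectangle {suc r} {suc v} (a , b , S⊆ , ⊆S) _ = rect a b r v
    , (λ p∈S → interval-bounds (proj₁ (S⊆ p∈S)) , interval-bounds (proj₂ (S⊆ p∈S)))
    , (λ (x , y) → ⊆S (bounds-interval x , bounds-interval y))

  -- Comparing unnormalised fractions means cross-multiplying; the rest clears the denominators.
  budget : ∀ M N → ℤ.+ N ℚᵘ./ 1 ℚᵘ.≥ (ℤ.+ 3 ℚᵘ./ 2) ℚᵘ.* (ℤ.+ M ℚᵘ./ 1) ℚᵘ.+ (ℤ.+ 2 ℚᵘ./ 1) →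
      3 * M + 4 ≤ 2 * N
  budget M N (*≤* le) = ℤ.drop‿+≤+ (subst₂ ℤ._≤_ lhs rhs le)
    where
    simplify : ∀ M → ((ℤ.+ 3 ℤ.* M) ℤ.* ℤ.+ 1 ℤ.+ ℤ.+ 2 ℤ.* ℤ.+ 2) ℤ.* ℤ.+ 1 ≡ ℤ.+ 3 ℤ.* M ℤ.+ ℤ.+ 4
    simplify = ℤ.solve-∀
    lhs : ((ℤ.+ 3 ℤ.* ℤ.+ M) ℤ.* ℤ.+ 1 ℤ.+ ℤ.+ 2 ℤ.* ℤ.+ 2) ℤ.* ℤ.+ 1 ≡ ℤ.+ (3 * M + 4)
    lhs = trans (simplify (ℤ.+ M)) (cong (ℤ._+ ℤ.+ 4) (sym (ℤ.pos-* 3 M)))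
    rhs : ℤ.+ N ℤ.* ℤ.+ 2 ≡ ℤ.+ (2 * N)
    rhs = trans (ℤ.*-comm (ℤ.+ N) (ℤ.+ 2)) (sym (ℤ.pos-* 2 N))

  spans-from : ∀ {S T : PositionSet} {X Y} → (∀ {p} → S p → p ∈ X) → span S ≐ T →
      (∀ {p} → p ∈ Y → T p) → Spans X Y
  spans-from {S} S⊆X (_ , T⊆) Y⊆T {C} closed X⊆C p∈Y =
      span⊆closed {S} {C} closed (X⊆C ∘ S⊆X) (T⊆ (Y⊆T p∈Y))

  ≐-trans : {S T U : PositionSet} → S ≐ T → T ≐ U → S ≐ U
  ≐-trans (S⊆T , T⊆S) (T⊆U , U⊆T) = (λ p∈ → T⊆U (S⊆T p∈)) , (λ p∈ → T⊆S (U⊆T p∈))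

  redundant-spans : ∀ B (red : HasRedundantCoins 2 B) →
      ∃[ Y ] 2 + length Y ≤ ∣ B ∣ × Y ⊆ coins B × Y ⇒[ ∣ B ∣ ] coins B
  redundant-spans B (b , b-injective , b∈B , supported) =
      B∖b , size , (λ p∈ → proj₁ (∈-filter⁻ _ {xs = coins B} p∈))
    -- The coins return in the opposite order: the supports of b₁ avoid b₀, whereas b₁ may itself
    -- support b₀.
    , grow (≤-trans (ℕ.n≤1+n _) size) support₁ ◅ grow size support₀ ◅ ⊆⇒ covers
    where
    b₀ = b Fin.zero
    b₁ = b (Fin.suc Fin.zero)
    B∖b = coins B ∖ˡ (b₀ ∷ b₁ ∷ [])
    b₀≢b₁ : b₀ ≢ b₁
    b₀≢b₁ eq with () ← b-injective eq
    size : 2 + length B∖b ≤ ∣ B ∣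
    size = ∖ˡ-length (unique B) ((b₀≢b₁ ∷ []) ∷ [] ∷ [])
        λ { (here refl) → b∈B Fin.zero ; (there (here refl)) → b∈B (Fin.suc Fin.zero) }
    kept : ∀ {q} → q ∈ coins B → q ≢ b₀ → q ≢ b₁ → q ∈ B∖b
    kept q∈B q≢b₀ q≢b₁ = ∈-filter⁺ _ q∈B λ { (here eq) → q≢b₀ eq ; (there (here eq)) → q≢b₁ eq }
    support₁ : Supported b₁ B∖b
    support₁ with q , r , q≢r , nq , nr , (q∈B , q∉) , (r∈B , r∉) ← supported (Fin.suc Fin.zero) =
      q , r , q≢r , nq , nr
      , kept q∈B (λ eq → q∉ (Fin.zero , s≤s z≤n , sym eq)) (not-own-neighbor nq)
      , kept r∈B (λ eq → r∉ (Fin.zero , s≤s z≤n , sym eq)) (not-own-neighbor nr)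
    support₀ : Supported b₀ (b₁ ∷ B∖b)
    support₀ with q , r , q≢r , nq , nr , (q∈B , _) , (r∈B , _) ← supported Fin.zero =
      q , r , q≢r , nq , nr , member q∈B (not-own-neighbor nq) , member r∈B (not-own-neighbor nr)
      where
      member : ∀ {q} → q ∈ coins B → q ≢ b₀ → q ∈ b₁ ∷ B∖b
      member {q} q∈B q≢b₀ with q ≟ b₁
      ... | yes eq   = here eq
      ... | no q≢b₁ = there (kept q∈B q≢b₀ q≢b₁)
    covers : coins B ⊆ b₀ ∷ b₁ ∷ B∖b
    covers {q} q∈B with q ≟ b₀ | q ≟ b₁
    ... | yes eq   | _       = here eq
    ... | no _     | yes eq  = there (here eq)
    ... | no q≢b₀ | no q≢b₁ = there (there (kept q∈B q≢b₀ q≢b₁))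

  extra-spans : ∀ A → HasExtraCoins 2 A →
      ∃[ X ] 2 + length X ≤ ∣ A ∣ × X ⊆ coins A × Spans X (coins A)
  extra-spans A (E , E⊆A , ∣E∣≡2 , same-span) = coins A ∖ˡ coins E
    , subst (λ k → k + length (coins A ∖ˡ coins E) ≤ ∣ A ∣) ∣E∣≡2
        (∖ˡ-length (unique A) (unique E) E⊆A)
    , (λ p∈ → proj₁ (∈-filter⁻ _ {xs = coins A} p∈))
    , λ {C} → spans-from (λ (p∈A , p∉E) → ∈-filter⁺ _ p∈A p∉E) same-span ⊆span {C}

  split-budget : ∀ M N → 3 * M + 4 ≤ 2 * N → ∃[ K ] N ≡ 2 + K × 3 * M ≤ 2 * K
  split-budget M 0 le with () ← ≤-trans (ℕ.m≤n+m 4 (3 * M)) le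
  split-budget M 1 le with s≤s (s≤s ()) ← ≤-trans (ℕ.m≤n+m 4 (3 * M)) le
  split-budget M (suc (suc K)) le =
      K , refl , ℕ.+-cancelʳ-≤ 4 (3 * M) (2 * K) (≤-trans le (≤-reflexive (double K)))
    where
    double : ∀ K → 2 * (2 + K) ≡ 2 * K + 4
    double = ℕ.solve-∀

  spanning-nonempty : ∀ X {p} → span (_∈ X) p → 1 ≤ length X
  spanning-nonempty [] p∈ = ⊥-elim
      (span⊆closed {C = λ _ → ⊥} (λ (_ , _ , _ , _ , _ , q , _) → q) (λ ()) p∈)
  spanning-nonempty (_ ∷ _) _ = s≤s z≤n

  solvable : ∀ (A B : Configuration) {N m n minA minB} → ∣ A ∣ ≡ N → ∣ B ∣ ≡ N →
    (∀ {p} → p ∈ coins B → span ⟦ A ⟧ p) → IsRectangle m n (span ⟦ A ⟧) →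
    HasExtraCoins 2 A → HasRedundantCoins 2 B → IsMin A minA → IsMin B minB →
    3 * (minA ℕ.⊔ minB) + 4 ≤ 2 * N → A ⟶* B
  solvable A B {N} ∣A∣≡N ∣B∣≡N B⊆spanA rectangular extra redundant
    ((A₀ , spanA₀ , refl) , _) ((B₀ , spanB₀ , refl) , _) 3M+4≤2N
    with K , refl , 3M≤2K ← split-budget (∣ A₀ ∣ ℕ.⊔ ∣ B₀ ∣) N 3M+4≤2N
    -- N = 2 + K is positive, so A and B have coins; these make the rectangle and the minimal set P
    -- nonempty.
    with a , a∈A ← some∈ {coins A} (≤-trans (s≤s z≤n) (≤-reflexive (sym ∣A∣≡N)))
       | b , b∈B ← some∈ {coins B} (≤-trans (s≤s z≤n) (≤-reflexive (sym ∣B∣≡N)))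
    with R , spanA≐R ← rectangle rectangular (⊆span a∈A)
       | X , X-size , X⊆A , X⇛A ← extra-spans A extra
       | Y , Y-size , Y⊆B , Y⇒B ← redundant-spans B redundant
    = realise-configuration A B ∣A∣≡N ∣B∣≡N X⊆A
        (  mutual-reach X⇛R R⇛X (≤-trans X-size (≤-reflexive ∣A∣≡N)) (s≤s (s≤s (≤M⇒≤K k≤M)))
        ◅◅ reach-inside R P P⊆R (spanning-nonempty P (proj₂ spanB₀ (⊆span b∈B))) 3M≤2K k≤M b≤M
        ◅◅ mutual-reach P⇛Y Y⇛P (s≤s (s≤s (≤M⇒≤K b≤M))) (≤-trans Y-size (≤-reflexive ∣B∣≡N))
        ◅◅ cap-mono (≤-reflexive ∣B∣≡N) Y⇒B )
    where
    P = coins B₀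
    M = ∣ A₀ ∣ ℕ.⊔ ∣ B₀ ∣
    R⇛ : ∀ {Z} → (∀ {p} → p ∈ Z → cells R p) → Spans (skeleton R) Z
    R⇛ Z⊆R {C} closed R⊆C p∈Z = skeleton-spans R {C} closed R⊆C (Z⊆R p∈Z)
    R⇛X : Spans (skeleton R) X
    R⇛X {C} = R⇛ (λ p∈X → proj₁ spanA≐R (⊆span (X⊆A p∈X))) {C}
    X⇛R : Spans X (skeleton R)
    X⇛R {C} closed X⊆C = spans-from id spanA≐R (skeleton⊆cells R) {C} closed (X⇛A {C} closed X⊆C)
    A₀≐R : span ⟦ A₀ ⟧ ≐ cells R
    A₀≐R = ≐-trans spanA₀ spanA≐R
    k≤M : length (skeleton R) ≤ M
    -- `A₀` also spans R, so it has at least as many coins as the chain of R.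
    k≤M = ≤-trans (skeleton-minimal R (λ {C} → spans-from id A₀≐R (skeleton⊆cells R) {C})
        (λ {C} → R⇛ (λ p∈ → proj₁ A₀≐R (⊆span p∈)) {C}))
      (ℕ.m≤m⊔n ∣ A₀ ∣ ∣ B₀ ∣)
    b≤M : length P ≤ M
    b≤M = ℕ.m≤n⊔m ∣ A₀ ∣ ∣ B₀ ∣
    P⊆R : ∀ {p} → p ∈ P → cells R p
    P⊆R p∈P = span⊆closed {⟦ B ⟧} {cells R} (cells-closed R) (λ q∈B → proj₁ spanA≐R (B⊆spanA q∈B))
        (proj₁ spanB₀ (⊆span p∈P))
    P⇛Y : Spans P Y
    P⇛Y {C} = spans-from id spanB₀ (λ p∈Y → ⊆span (Y⊆B p∈Y)) {C}
    Y⇛P : Spans Y P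
    Y⇛P {C} closed Y⊆C p∈P = span⊆closed {⟦ B ⟧} {C} closed (⇒-closed closed Y⇒B Y⊆C)
        (proj₁ spanB₀ (⊆span p∈P))
    open Budget {M} {K} {length (skeleton R)} {length P} 3M≤2K k≤M b≤M

open import Data.Integer using (+_)
open import Data.Nat using (ℕ; _⊔_)
open import Data.Rational.Unnormalised using (_/_; _+_; _*_; _≥_)
open import Relation.Binary.PropositionalEquality using (_≡_)
open import Relation.Unary using (_⊇_)

theorem4p8 : (A B : Configuration) (N : ℕ) → ∣ A ∣ ≡ N → ∣ B ∣ ≡ N →
    (m n : ℕ) → span ⟦ A ⟧ ⊇ ⟦ B ⟧ → IsRectangle m n (span ⟦ A ⟧) →
    HasExtraCoins 2 A →
    HasRedundantCoins 2 B →
    (minA minB : ℕ) → IsMin A minA → IsMin B minB →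
    + N / 1 ≥ (+ 3 / 2) * (+ (minA ⊔ minB) / 1) + (+ 2 / 1) →
    A ⟶* B
theorem4p8 A B N ∣A∣≡N ∣B∣≡N m n B⊆spanA rectangular extra redundant minA minB isMinA isMinB N≥ =
  CoinGame.solvable A B ∣A∣≡N ∣B∣≡N B⊆spanA rectangular extra redundant isMinA isMinB
    (CoinGame.budget (minA ⊔ minB) N N≥)
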